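{- Let $\mathbb F_q$ be a finite field, $t,n$ positive integers with $n<\frac{t-1}{2}$, and $d_1>\cdots>d_t\ge 2$ integers not divisible by $\mathrm{char}(\mathbb F_q)$. Let $c_{ji}$ ($1\le i,j\le n$) be positive integers with $c_{j1}+\cdots+c_{jn}<d_t$ for each $j$. Let $A=(a_{ji})\in\mathbb F_q^{n\times t}$ satisfy hypothesis (H), let $a_1,\dots,a_n\in\mathbb F_q$ with $a_j\ne 0$ for some $j$, and $b_1,\dots,b_n\in\mathbb F_q\setminus\{0\}$. Then the number $N$ of solutions in $\mathbb F_q^t$ of the system $$\sum_{i=1}^t a_{ji}X_i^{d_i}+a_j=b_jX_1^{c_{j1}}\cdots X_n^{c_{jn}},\qquad 1\le j\le n,$$ satisfies $\big|N-q^{t-n}\big|\le q^{t/2}(6n d_1)^{t+1}$.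
   Context: Hypothesis (H) on $A\in\mathbb F_q^{n\times t}$: every $n\times n$ submatrix of $A$ (formed by any choice of $n$ columns) has rank $n$. -}

module Defs where

open import Algebra.Bundles using (CommutativeRing; Monoid; Semiring)
import Algebra.Definitions
import Algebra.Definitions.RawMonoid
import Algebra.Definitions.RawSemiring
open import Data.Fin.Base as Fin using (Fin; zero; inject≤; fromℕ; finToFun)
open import Data.Fin.Properties using (inj⇒≟; all?)
open import Data.List.Base using (length; filter; allFin)
open import Data.Nat.Base as ℕ using (ℕ; suc; NonZero; _≤_; _<_)
open import Data.Nat.Properties as ℕ using ()
open import Data.Product.Base using (_×_; ∃-syntax)
open import Data.Vec.Functional using (Vector)
open import Function.Base using (_∘_)
open import Function.Bundles using (Inverse)
open import Function.Properties.Inverse using (Inverse⇒Injection)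
open import Level using (Level; _⊔_) renaming (suc to lsuc)
open import Relation.Binary.Core using (_Preserves_⟶_)
open import Relation.Binary.Definitions using () renaming (Decidable to Decidable₂)
import Relation.Binary.PropositionalEquality as ≡
open import Relation.Nullary.Negation using (¬_)
open import Relation.Unary using (Pred; Decidable)

firstIndex : ∀ t → .{{NonZero t}} → Fin t
firstIndex (suc _) = zero

lastIndex : ∀ t → .{{NonZero t}} → Fin t
lastIndex (suc t) = fromℕ t

-- For t > 0, truncated subtraction is harmless: the premise is n < (t - 1) / 2.
2n<t-1⇒n≤t : ∀ {n t} → 2 ℕ.* n < t ℕ.∸ 1 → n ≤ t
2n<t-1⇒n≤t {n} {t} h =
  ℕ.≤-trans (ℕ.m≤m+n n _) (ℕ.≤-trans (ℕ.<⇒≤ h) (ℕ.m∸n≤m t 1))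

StrictlyIncreasing : ∀ {k t} → (Fin k → Fin t) → Set
StrictlyIncreasing σ = σ Preserves Fin._<_ ⟶ Fin._<_

StrictlyDecreasing : ∀ {t} → Vector ℕ t → Set
StrictlyDecreasing d = d Preserves Fin._<_ ⟶ ℕ._>_

record FiniteField c ℓ : Set (lsuc (c ⊔ ℓ)) where
  field
    commutativeRing : CommutativeRing c ℓ

  open CommutativeRing commutativeRing public

  field
    0≉1           : ¬ (0# ≈ 1#)
    ≉0⇒invertible : ∀ {x} → ¬ (x ≈ 0#) → Algebra.Definitions.Invertible _≈_ 1# _*_ x
    q             : ℕ
    enumeration   : Inverse setoid (≡.setoid (Fin q))

  _≟_ : Decidable₂ _≈_
  _≟_ = inj⇒≟ (Inverse⇒Injection enumeration)

  open Algebra.Definitions.RawMonoid (Monoid.rawMonoid +-monoid) public using (sum) renaming (_×_ to _·_)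
  open Algebra.Definitions.RawMonoid (Monoid.rawMonoid *-monoid) public using () renaming (sum to product)
  open Algebra.Definitions.RawSemiring (Semiring.rawSemiring semiring) public using (_^_)

  IsCharacteristic : ℕ → Set ℓ
  IsCharacteristic p =
    0 < p × p · 1# ≈ 0# × (∀ m → 0 < m → m · 1# ≈ 0# → p ≤ m)

  Matrix : ℕ → ℕ → Set c
  Matrix m n = Vector (Vector Carrier n) m

  selectColumns : ∀ {m n k} → (Fin k → Fin n) → Matrix m n → Matrix m k
  selectColumns σ M j = M j ∘ σ

  ColumnsIndependent : ∀ {m k} → Matrix m k → Set (c ⊔ ℓ)
  ColumnsIndependent {m} {k} M =
    ∀ (x : Vector Carrier k) →
    (∀ j → sum (λ i → x i * M j i) ≈ 0#) → ∀ i → x i ≈ 0#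

  -- The rank is the largest number of linearly independent columns.  A
  -- selection σ with independent columns is necessarily injective, as 0 ≉ 1.
  HasRank : ∀ {m n} → Matrix m n → ℕ → Set (c ⊔ ℓ)
  HasRank {m} {n} M r =
    (∃[ σ ] ColumnsIndependent (selectColumns {k = r} σ M)) ×
    (∀ k (σ : Fin k → Fin n) → ColumnsIndependent (selectColumns σ M) → k ≤ r)

  HypothesisH : ∀ {n t} → Matrix n t → Set (c ⊔ ℓ)
  HypothesisH {n} {t} A =
    ∀ (σ : Fin n → Fin t) → StrictlyIncreasing σ → HasRank (selectColumns σ A) n

  -- fromIndex runs once through each element of Carrier^t, up to pointwise
  -- _≈_, so countPoints is meaningful for predicates that respect _≈_.
  fromIndex : ∀ {t} → Fin (q ℕ.^ t) → Vector Carrier t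
  fromIndex k = Inverse.from enumeration ∘ finToFun k

  countPoints : ∀ {t p} {P : Pred (Vector Carrier t) p} → Decidable P → ℕ
  countPoints {t} P? = length (filter (P? ∘ fromIndex) (allFin (q ℕ.^ t)))

  module System
    {n t : ℕ} (n≤t : n ≤ t)
    (d : Vector ℕ t) (c : Fin n → Vector ℕ n)
    (A : Matrix n t) (a b : Vector Carrier n)
    where

    lhs rhs : Vector Carrier t → Vector Carrier n
    lhs X j = sum (λ i → A j i * X i ^ d i) + a j
    rhs X j = b j * product (λ i → X (inject≤ i n≤t) ^ c j i)

    IsSolution : Pred (Vector Carrier t) ℓ
    IsSolution X = ∀ j → lhs X j ≈ rhs X j

    isSolution? : Decidable IsSolution
    isSolution? X = all? (λ j → lhs X j ≟ rhs X j)

    solutionCount : ℕ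
    solutionCount = countPoints isSolution?

{-# OPTIONS --safe #-}

-- Let V = F_q^n.  Fix the first n variables x: the system then says that f x + g y = 0 in
-- V, where g y = Σ_{i>n} y_i^{d_i} A_i is a sum of contributions along the
-- remaining columns A_i of A.  With h₀ = q^n δ_0 - 1 on V,
--   q^n (N - q^{t-n}) = Σ_x Ψ (f x),   Ψ v = Σ_y h₀ (v + g y),
-- and two second moment estimates suffice.
--
-- (1) The fibres of f have at most d_1^n points.  Inverting the first n columns, a fibre
-- is cut out by equations x_i^{d_i} = (polynomial of degree < d_i), so every function on
-- it is a combination of the monomials with exponents below d_1.  By Cauchy-Schwarz
-- (Σ_x Ψ (f x))² ≤ q^n d_1^n ‖Ψ‖².
--
-- (2) For a column A_i compare P h v = Σ_y h (v + y^d A_i) with the full average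
-- B h v = Σ_s h (v + s A_i).  Scaling y^d by u ∈ F_q and summing ‖P_u h‖² over u gives
-- ‖P h‖² ≤ 2 d² (q ‖h‖² + ‖B h‖²) without any exponential sums.  Expanding
-- Ψ = P_{n+1} ... P_t h₀ this way leaves products of B's over sets S of columns applied to
-- h₀; by hypothesis (H) their squared norm is at most q^{2n+|S|}, and they vanish for
-- |S| = n.  Hence ‖Ψ‖² ≤ (4 d_1²)^{t-n} q^{t+n}.
module Submission where

open import Defs
open import Data.Nat.Base as ℕ using (ℕ; NonZero; _≤_; _<_; _∸_; ∣_-_∣; +-0-rawMonoid)
open import Algebra.Definitions.RawMonoid +-0-rawMonoid using () renaming (sum to sumℕ)
open import Data.Fin.Base using (Fin)
open import Data.Nat.Divisibility using (_∣_)
open import Data.Product.Base using (∃-syntax)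
open import Data.Vec.Functional using (Vector)
open import Relation.Nullary.Negation using (¬_)

open import Algebra.Bundles using (CommutativeMonoid; Group)
import Algebra.Properties.CommutativeMonoid.Sum
import Algebra.Properties.Group
open import Algebra.Structures using (IsAbelianGroup)
open import Data.Fin.Base as Fin
  using (zero; suc; toℕ; fromℕ; inject₁; inject≤; finToFun; funToFin; combine; _↑ˡ_; _↑ʳ_)
open import Data.Fin.Permutation using (Permutation; permutation; _⟨$⟩ʳ_)
open import Data.Fin.Properties as Fin using ()
open import Data.Integer.Base as ℤ using (ℤ; +_; 0ℤ; 1ℤ)
open import Data.Integer.Properties as ℤ using ()
open import Data.Integer.Tactic.RingSolver using (solve-∀)
open import Data.List.Base using (length; filter; tabulate)
open import Data.Nat.Base using (zero; suc)
open import Data.Nat.Properties as ℕ using ()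
import Data.Nat.Tactic.RingSolver as ℕ-RingSolver
open import Data.Product.Base using (_,_; proj₁; proj₂; _×_; Σ-syntax)
open import Data.Sum.Base using (inj₁; inj₂)
open import Data.Vec.Functional as Vector using ()
open import Data.Vec.Functional.Properties using (∷-cong; ++-cong; lookup-++ˡ; lookup-++ʳ)
open import Function.Base using (_∘_)
open import Function.Bundles using (Inverse)
open import Function.Definitions using (Injective)
open import Relation.Binary.PropositionalEquality as ≡ using (_≡_; _≢_; refl; cong; cong₂; _≗_)
open import Relation.Nullary using (Dec; yes; no; contradiction)
open import Relation.Unary using (Pred; Decidable)
import Algebra.Properties.Semiring.Sum ℤ.+-*-semiring as Sum

-- Finite sums of integers

module _ {c ℓ} (M : CommutativeMonoid c ℓ) where
  open CommutativeMonoid M hiding (refl)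
  open Algebra.Properties.CommutativeMonoid.Sum M

  sum-zero : ∀ {n} (t : Vector Carrier n) → (∀ j → t j ≈ ε) → sum t ≈ ε
  sum-zero {n} t t≈ε = trans (sum-cong-≋ t≈ε) (sum-replicate-zero n)

  sum-single : ∀ {n} (i : Fin n) (t : Vector Carrier n) → (∀ j → j ≢ i → t j ≈ ε) → sum t ≈ t i
  sum-single zero    t t≈ε = trans (∙-congˡ (sum-zero (t ∘ suc) (λ j → t≈ε (suc j) λ ()))) (identityʳ (t zero))
  sum-single (suc i) t t≈ε = trans (∙-congʳ (t≈ε zero λ ())) (trans (identityˡ _)
    (sum-single i (t ∘ suc) (λ j j≢i → t≈ε (suc j) (λ eq → j≢i (Fin.suc-injective eq)))))

  sum-++ : ∀ m {n} (t : Vector Carrier (m ℕ.+ n)) →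
    sum t ≈ sum (λ i → t (i ↑ˡ n)) ∙ sum (λ j → t (m ↑ʳ j))
  sum-++ zero    t = sym (identityˡ _)
  sum-++ (suc m) t = trans (∙-congˡ (sum-++ m (t ∘ suc))) (sym (assoc (t zero) _ _))

-- Opaque, so that unification can read off the summand.
opaque
  ∑ : ∀ {n} → Vector ℤ n → ℤ
  ∑ = Sum.sum

  ∑-empty : (f : Vector ℤ 0) → ∑ f ≡ 0ℤ
  ∑-empty f = refl

  ∑-suc : ∀ {n} (f : Vector ℤ (suc n)) → ∑ f ≡ f zero ℤ.+ ∑ (f ∘ suc)
  ∑-suc f = refl

  ∑-cong : ∀ {n} {f g : Vector ℤ n} → f ≗ g → ∑ f ≡ ∑ g
  ∑-cong = Sum.sum-cong-≗

  ∑-+ : ∀ {n} (f g : Vector ℤ n) → ∑ (λ i → f i ℤ.+ g i) ≡ ∑ f ℤ.+ ∑ g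
  ∑-+ = Sum.∑-distrib-+

  ∑-swap : ∀ {m n} (f : Fin m → Fin n → ℤ) → ∑ (λ i → ∑ (λ j → f i j)) ≡ ∑ (λ j → ∑ (λ i → f i j))
  ∑-swap = Sum.∑-comm

  *-∑ : ∀ {n} x (f : Vector ℤ n) → x ℤ.* ∑ f ≡ ∑ (λ i → x ℤ.* f i)
  *-∑ = Sum.*-distribˡ-sum

  ∑-* : ∀ {n} x (f : Vector ℤ n) → ∑ f ℤ.* x ≡ ∑ (λ i → f i ℤ.* x)
  ∑-* = Sum.*-distribʳ-sum

  ∑-permute : ∀ {m n} (f : Vector ℤ n) (π : Permutation m n) → ∑ f ≡ ∑ (λ i → f (π ⟨$⟩ʳ i))
  ∑-permute = Sum.sum-permute

  ∑-++ : ∀ m {n} (f : Vector ℤ (m ℕ.+ n)) → ∑ f ≡ ∑ (λ i → f (i ↑ˡ n)) ℤ.+ ∑ (λ j → f (m ↑ʳ j))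
  ∑-++ = sum-++ ℤ.+-0-commutativeMonoid

  ∑-mono : ∀ {n} {f g : Vector ℤ n} → (∀ i → f i ℤ.≤ g i) → ∑ f ℤ.≤ ∑ g
  ∑-mono {zero}  f≤g = ℤ.≤-refl
  ∑-mono {suc n} f≤g = ℤ.+-mono-≤ (f≤g zero) (∑-mono (f≤g ∘ suc))

∑-const : ∀ n c → ∑ {n} (λ _ → c) ≡ + n ℤ.* c
∑-const zero    c = ≡.trans (∑-empty _) (≡.sym (ℤ.*-zeroˡ c))
∑-const (suc n) c = begin
  ∑ {suc n} (λ _ → c)    ≡⟨ ∑-suc _ ⟩
  c ℤ.+ ∑ {n} (λ _ → c)  ≡⟨ cong (λ z → c ℤ.+ z) (∑-const n c) ⟩
  c ℤ.+ + n ℤ.* c        ≡⟨ ℤ.suc-* (+ n) c ⟨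
  ℤ.suc (+ n) ℤ.* c      ∎
  where open ≡.≡-Reasoning

∑-zero : ∀ {n} {f : Vector ℤ n} → (∀ i → f i ≡ 0ℤ) → ∑ f ≡ 0ℤ
∑-zero {n} f≡0 = ≡.trans (∑-cong f≡0) (≡.trans (∑-const n 0ℤ) (ℤ.*-zeroʳ (+ n)))

∑-nonneg : ∀ {n} {f : Vector ℤ n} → (∀ i → 0ℤ ℤ.≤ f i) → 0ℤ ℤ.≤ ∑ f
∑-nonneg {n} {f} 0≤f = ≡.subst (ℤ._≤ ∑ f) (∑-zero {n} {λ _ → 0ℤ} (λ _ → refl)) (∑-mono 0≤f)

∑-product : ∀ {m n} (f : Vector ℤ m) (g : Vector ℤ n) →
  ∑ f ℤ.* ∑ g ≡ ∑ (λ i → ∑ (λ j → f i ℤ.* g j))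
∑-product f g = ≡.trans (∑-* (∑ g) f) (∑-cong (λ i → *-∑ (f i) g))

sq-nonneg : ∀ x → 0ℤ ℤ.≤ x ℤ.* x
sq-nonneg (+ n)       = ≡.subst (0ℤ ℤ.≤_) (ℤ.pos-* n n) (ℤ.+≤+ ℕ.z≤n)
sq-nonneg (ℤ.-[1+ n ]) = ℤ.+≤+ ℕ.z≤n

ℤ+-cancelˡ-≤ : ∀ x y z → x ℤ.+ y ℤ.≤ x ℤ.+ z → y ℤ.≤ z
ℤ+-cancelˡ-≤ x y z le = ≡.subst₂ ℤ._≤_ (cancel x y) (cancel x z) (ℤ.+-monoʳ-≤ (ℤ.- x) le)
  where
  cancel : ∀ x y → ℤ.- x ℤ.+ (x ℤ.+ y) ≡ y
  cancel = solve-∀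

indicator : ∀ {p} {P : Set p} → Dec P → ℤ
indicator (yes _) = 1ℤ
indicator (no  _) = 0ℤ

indicator-⇔ : ∀ {p r} {P : Set p} {R : Set r} (P? : Dec P) (R? : Dec R) →
  (P → R) → (R → P) → indicator P? ≡ indicator R?
indicator-⇔ (yes _) (yes _) _ _ = refl
indicator-⇔ (no  _) (no  _) _ _ = refl
indicator-⇔ (yes x) (no ¬y) f _ = contradiction (f x) ¬y
indicator-⇔ (no ¬x) (yes y) _ g = contradiction (g y) ¬x

∑-indicator : ∀ {n} (j : Fin n) (f : Vector ℤ n) →
  ∑ (λ i → indicator (j Fin.≟ i) ℤ.* f i) ≡ f j
∑-indicator {suc n} zero f = begin
  ∑ (λ i → indicator (zero Fin.≟ i) ℤ.* f i)  ≡⟨ ∑-suc _ ⟩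
  1ℤ ℤ.* f zero ℤ.+ ∑ (λ i → indicator (zero Fin.≟ suc i) ℤ.* f (suc i))
    ≡⟨ cong₂ ℤ._+_ (ℤ.*-identityˡ (f zero)) (∑-zero {n} (λ i → ℤ.*-zeroˡ (f (suc i)))) ⟩
  f zero ℤ.+ 0ℤ  ≡⟨ ℤ.+-identityʳ _ ⟩
  f zero         ∎
  where open ≡.≡-Reasoning
∑-indicator {suc n} (suc j) f = begin
  ∑ (λ i → indicator (suc j Fin.≟ i) ℤ.* f i)  ≡⟨ ∑-suc _ ⟩
  0ℤ ℤ.* f zero ℤ.+ ∑ (λ i → indicator (suc j Fin.≟ suc i) ℤ.* f (suc i))
    ≡⟨ cong₂ ℤ._+_ (ℤ.*-zeroˡ (f zero)) (∑-cong λ i → cong (ℤ._* f (suc i))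
         (indicator-⇔ (suc j Fin.≟ suc i) (j Fin.≟ i) Fin.suc-injective (cong suc))) ⟩
  0ℤ ℤ.+ ∑ (λ i → indicator (j Fin.≟ i) ℤ.* f (suc i))  ≡⟨ ℤ.+-identityˡ _ ⟩
  ∑ (λ i → indicator (j Fin.≟ i) ℤ.* f (suc i))         ≡⟨ ∑-indicator j (f ∘ suc) ⟩
  f (suc j)  ∎
  where open ≡.≡-Reasoning

∑-fibres : ∀ {m n} (φ : Fin m → Fin n) (g : Vector ℤ n) →
  ∑ (g ∘ φ) ≡ ∑ (λ j → ∑ (λ i → indicator (φ i Fin.≟ j)) ℤ.* g j)
∑-fibres φ g = begin
  ∑ (λ i → g (φ i))                                        ≡⟨ ∑-cong (λ i → ∑-indicator (φ i) g) ⟨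
  ∑ (λ i → ∑ (λ j → indicator (φ i Fin.≟ j) ℤ.* g j))      ≡⟨ ∑-swap (λ i j → indicator (φ i Fin.≟ j) ℤ.* g j) ⟩
  ∑ (λ j → ∑ (λ i → indicator (φ i Fin.≟ j) ℤ.* g j))      ≡⟨ ∑-cong (λ j → ∑-* (g j) (λ i → indicator (φ i Fin.≟ j))) ⟨
  ∑ (λ j → ∑ (λ i → indicator (φ i Fin.≟ j)) ℤ.* g j)      ∎
  where open ≡.≡-Reasoning

-- Used for two maps with small fibres: raising to the `d`-th power in the field, and the map `f` on
-- the first `n` variables.
∑-fibres-≤ : ∀ {m n} (φ : Fin m → Fin n) (g : Vector ℤ n) {D : ℤ} →
  (∀ j → 0ℤ ℤ.≤ g j) → (∀ j → ∑ (λ i → indicator (φ i Fin.≟ j)) ℤ.≤ D) →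
  ∑ (g ∘ φ) ℤ.≤ D ℤ.* ∑ g
∑-fibres-≤ φ g {D} 0≤g fib = begin
  ∑ (g ∘ φ)                                            ≡⟨ ∑-fibres φ g ⟩
  ∑ (λ j → ∑ (λ i → indicator (φ i Fin.≟ j)) ℤ.* g j)
    ≤⟨ ∑-mono (λ j → ℤ.*-monoʳ-≤-nonNeg (g j) {{ℤ.nonNegative (0≤g j)}} (fib j)) ⟩
  ∑ (λ j → D ℤ.* g j)                                  ≡⟨ *-∑ D g ⟨
  D ℤ.* ∑ g                                            ∎
  where open ℤ.≤-Reasoning

-- 0 ≤ ∑ᵢⱼ (f i - f j)² = 2 (n ∑ f² - (∑ f)²)
cauchy-schwarz : ∀ {n} (f : Vector ℤ n) →
  ∑ f ℤ.* ∑ f ℤ.≤ + n ℤ.* ∑ (λ i → f i ℤ.* f i)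
cauchy-schwarz {n} f = ℤ.*-cancelˡ-≤-pos _ _ (+ 2) (ℤ.0≤i-j⇒j≤i (≡.subst (0ℤ ℤ.≤_) expand
    (∑-nonneg (λ i → ∑-nonneg (λ j → sq-nonneg (f i ℤ.- f j))))))
  where
  open ≡.≡-Reasoning
  F² = ∑ (λ i → f i ℤ.* f i)
  binomial : ∀ x y → (x ℤ.- y) ℤ.* (x ℤ.- y) ≡ x ℤ.* x ℤ.+ (y ℤ.* y ℤ.+ ℤ.- (+ 2) ℤ.* (x ℤ.* y))
  binomial = solve-∀
  collect : ∀ a b k → k ℤ.* a ℤ.+ (k ℤ.* a ℤ.+ ℤ.- (+ 2) ℤ.* (b ℤ.* b)) ≡ + 2 ℤ.* (k ℤ.* a) ℤ.- + 2 ℤ.* (b ℤ.* b)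
  collect = solve-∀
  row : ∀ i → ∑ (λ j → (f i ℤ.- f j) ℤ.* (f i ℤ.- f j)) ≡
              + n ℤ.* (f i ℤ.* f i) ℤ.+ (F² ℤ.+ ℤ.- (+ 2) ℤ.* ∑ (λ j → f i ℤ.* f j))
  row i = begin
    ∑ (λ j → (f i ℤ.- f j) ℤ.* (f i ℤ.- f j))
      ≡⟨ ∑-cong (λ j → binomial (f i) (f j)) ⟩
    ∑ (λ j → f i ℤ.* f i ℤ.+ (f j ℤ.* f j ℤ.+ ℤ.- (+ 2) ℤ.* (f i ℤ.* f j)))
      ≡⟨ ∑-+ (λ _ → f i ℤ.* f i) _ ⟩
    ∑ {n} (λ _ → f i ℤ.* f i) ℤ.+ ∑ (λ j → f j ℤ.* f j ℤ.+ ℤ.- (+ 2) ℤ.* (f i ℤ.* f j))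
      ≡⟨ cong₂ ℤ._+_ (∑-const n _) (∑-+ (λ j → f j ℤ.* f j) _) ⟩
    + n ℤ.* (f i ℤ.* f i) ℤ.+ (F² ℤ.+ ∑ (λ j → ℤ.- (+ 2) ℤ.* (f i ℤ.* f j)))
      ≡⟨ cong (λ z → + n ℤ.* (f i ℤ.* f i) ℤ.+ (F² ℤ.+ z)) (*-∑ (ℤ.- (+ 2)) (λ j → f i ℤ.* f j)) ⟨
    _ ∎
  expand : ∑ (λ i → ∑ (λ j → (f i ℤ.- f j) ℤ.* (f i ℤ.- f j))) ≡
           + 2 ℤ.* (+ n ℤ.* F²) ℤ.- + 2 ℤ.* (∑ f ℤ.* ∑ f)
  expand = begin
    ∑ (λ i → ∑ (λ j → (f i ℤ.- f j) ℤ.* (f i ℤ.- f j)))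
      ≡⟨ ∑-cong row ⟩
    ∑ (λ i → + n ℤ.* (f i ℤ.* f i) ℤ.+ (F² ℤ.+ ℤ.- (+ 2) ℤ.* ∑ (λ j → f i ℤ.* f j)))
      ≡⟨ ∑-+ (λ i → + n ℤ.* (f i ℤ.* f i)) _ ⟩
    ∑ (λ i → + n ℤ.* (f i ℤ.* f i)) ℤ.+ ∑ (λ i → F² ℤ.+ ℤ.- (+ 2) ℤ.* ∑ (λ j → f i ℤ.* f j))
      ≡⟨ cong₂ ℤ._+_ (≡.sym (*-∑ (+ n) _)) (∑-+ {n} (λ _ → F²) _) ⟩
    + n ℤ.* F² ℤ.+ (∑ {n} (λ _ → F²) ℤ.+ ∑ (λ i → ℤ.- (+ 2) ℤ.* ∑ (λ j → f i ℤ.* f j)))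
      ≡⟨ cong₂ (λ x y → + n ℤ.* F² ℤ.+ (x ℤ.+ y)) (∑-const n F²)
           (≡.trans (≡.sym (*-∑ (ℤ.- (+ 2)) (λ i → ∑ (λ j → f i ℤ.* f j)))) (cong (ℤ.- (+ 2) ℤ.*_) (≡.sym (∑-product f f)))) ⟩
    + n ℤ.* F² ℤ.+ (+ n ℤ.* F² ℤ.+ ℤ.- (+ 2) ℤ.* (∑ f ℤ.* ∑ f))
      ≡⟨ collect F² (∑ f) (+ n) ⟩
    _ ∎

length-filter : ∀ {n p} {A : Set} {P : Pred A p} (P? : Decidable P) (f : Fin n → A) →
  + length (filter P? (tabulate f)) ≡ ∑ (λ i → indicator (P? (f i)))
length-filter {zero}  P? f = ≡.sym (∑-empty _)
length-filter {suc n} P? f = ≡.trans step (≡.sym (∑-suc _))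
  where
  step : + length (filter P? (tabulate f)) ≡ indicator (P? (f zero)) ℤ.+ ∑ (λ i → indicator (P? (f (suc i))))
  step with P? (f zero)
  ... | yes _ = cong (λ z → 1ℤ ℤ.+ z) (length-filter P? (f ∘ suc))
  ... | no  _ = ≡.trans (length-filter P? (f ∘ suc)) (≡.sym (ℤ.+-identityˡ _))

-- Sums over vectors with entries in a finite set

∑-combine : ∀ m {n} (f : Vector ℤ (m ℕ.* n)) → ∑ f ≡ ∑ (λ (i : Fin m) → ∑ (λ (j : Fin n) → f (combine i j)))
∑-combine zero        f = ≡.trans (∑-empty _) (≡.sym (∑-empty _))
∑-combine (suc m) {n} f = begin
  ∑ f                                                         ≡⟨ ∑-++ n f ⟩
  ∑ (λ j → f (j ↑ˡ (m ℕ.* n))) ℤ.+ ∑ (λ k → f (n ↑ʳ k))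
    ≡⟨ cong (λ z → ∑ (λ j → f (j ↑ˡ (m ℕ.* n))) ℤ.+ z) (∑-combine m (λ k → f (n ↑ʳ k))) ⟩
  ∑ (λ j → f (j ↑ˡ (m ℕ.* n))) ℤ.+ ∑ (λ (i : Fin m) → ∑ (λ j → f (n ↑ʳ combine i j))) ≡⟨ ∑-suc _ ⟨
  ∑ (λ (i : Fin (suc m)) → ∑ (λ (j : Fin n) → f (combine i j))) ∎
  where open ≡.≡-Reasoning

∑ᵛ : ∀ q k → ((Fin k → Fin q) → ℤ) → ℤ
∑ᵛ q k φ = ∑ (λ (x : Fin (q ℕ.^ k)) → φ (finToFun x))

-- Decoding a combined index agrees with the corresponding vector only pointwise, so the splitting
-- lemmas ask that summands respect pointwise equality.
Extensional : ∀ {q k} → ((Fin k → Fin q) → ℤ) → Set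
Extensional φ = ∀ {x y} → x ≗ y → φ x ≡ φ y

∑ᵛ-suc : ∀ {q k} (φ : (Fin (suc k) → Fin q) → ℤ) → Extensional φ →
  ∑ᵛ q (suc k) φ ≡ ∑ (λ s → ∑ᵛ q k (λ x → φ (s Vector.∷ x)))
∑ᵛ-suc {q} {k} φ φ-ext = ≡.trans (∑-combine q (φ ∘ finToFun)) (∑-cong λ s → ∑-cong λ x → φ-ext (split s x))
  where
  split : ∀ s x → finToFun (combine s x) ≗ (s Vector.∷ finToFun x)
  split s x zero    = cong proj₁ (Fin.remQuot-combine {q} {q ℕ.^ k} s x)
  split s x (suc i) = cong (λ z → finToFun (proj₂ z) i) (Fin.remQuot-combine {q} {q ℕ.^ k} s x)

concat : ∀ {q} m {n} → (Fin m → Fin q) → (Fin n → Fin q) → Fin (m ℕ.+ n) → Fin q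
concat m x y = Vector._++_ {m = m} x y

∷-concat : ∀ {q} m {n} (s : Fin q) (x : Fin m → Fin q) (y : Fin n → Fin q) →
  concat (suc m) (s Vector.∷ x) y ≗ (s Vector.∷ concat m x y)
∷-concat m s x y zero = refl
∷-concat m s x y (suc i) with Fin.splitAt m i
... | inj₁ _ = refl
... | inj₂ _ = refl

∑ᵛ-++ : ∀ q m n (φ : (Fin (m ℕ.+ n) → Fin q) → ℤ) → Extensional φ →
  ∑ᵛ q (m ℕ.+ n) φ ≡ ∑ᵛ q m (λ x → ∑ᵛ q n (λ y → φ (concat m x y)))
∑ᵛ-++ q zero n φ φ-ext = begin
  ∑ᵛ q n φ
    ≡⟨ ∑-cong (λ y → φ-ext (λ _ → refl)) ⟩
  ∑ᵛ q n (λ y → φ (concat 0 (finToFun zero) y))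
    ≡⟨ ℤ.+-identityʳ _ ⟨
  ∑ᵛ q n (λ y → φ (concat 0 (finToFun zero) y)) ℤ.+ 0ℤ
    ≡⟨ cong (λ z → ∑ᵛ q n (λ y → φ (concat 0 (finToFun zero) y)) ℤ.+ z) (∑-empty _) ⟨
  _ ≡⟨ ∑-suc _ ⟨
  ∑ᵛ q 0 (λ x → ∑ᵛ q n (λ y → φ (concat 0 x y))) ∎
  where open ≡.≡-Reasoning
∑ᵛ-++ q (suc m) n φ φ-ext = begin
  ∑ᵛ q (suc m ℕ.+ n) φ
    ≡⟨ ∑ᵛ-suc φ φ-ext ⟩
  ∑ (λ s → ∑ᵛ q (m ℕ.+ n) (λ z → φ (s Vector.∷ z)))
    ≡⟨ ∑-cong (λ s → ∑ᵛ-++ q m n (λ z → φ (s Vector.∷ z)) (λ z≗z′ → φ-ext (∷-cong refl z≗z′))) ⟩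
  ∑ (λ s → ∑ᵛ q m (λ x → ∑ᵛ q n (λ y → φ (s Vector.∷ concat m x y))))
    ≡⟨ ∑-cong (λ s → ∑-cong λ x → ∑-cong λ y → φ-ext (∷-concat m s (finToFun x) (finToFun y))) ⟨
  ∑ (λ s → ∑ᵛ q m (λ x → ∑ᵛ q n (λ y → φ (concat (suc m) (s Vector.∷ x) y))))
    ≡⟨ ∑ᵛ-suc (λ x → ∑ᵛ q n (λ y → φ (concat (suc m) x y)))
         (λ {x} {x′} x≗x′ → ∑-cong λ y → φ-ext (++-cong x x′ x≗x′ (λ _ → refl))) ⟨
  ∑ᵛ q (suc m) (λ x → ∑ᵛ q n (λ y → φ (concat (suc m) x y))) ∎
  where open ≡.≡-Reasoning

-- Sums of translates on a finite abelian group

module Translations {M : ℕ} (_⊕_ : Fin M → Fin M → Fin M) (𝟎 : Fin M) (⊖_ : Fin M → Fin M)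
  (isAbelianGroup : IsAbelianGroup _≡_ _⊕_ 𝟎 ⊖_) where

  private module V = IsAbelianGroup isAbelianGroup

  private
    group : Group _ _
    group = record { isGroup = V.isGroup }
  open Algebra.Properties.Group group public
    using () renaming (//-rightDividesˡ to cancel-⊖; //-rightDividesʳ to cancel-⊕)

  infixl 6 _⊖_
  _⊖_ : Fin M → Fin M → Fin M
  v ⊖ w = v ⊕ (⊖ w)

  ∑-translate : ∀ (g : Fin M → ℤ) w → ∑ (λ v → g (v ⊕ w)) ≡ ∑ g
  ∑-translate g w = ≡.sym (∑-permute g (permutation (_⊕ w) (_⊖ w)
    (cancel-⊖ w) (cancel-⊕ w)))

  -- Up to reflection this is convolution of `h` with the counting measure of the family `μ`. All
  -- averages in the proof have this form, and therefore commute.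
  T : ∀ {k} → (Fin k → Fin M) → (Fin M → ℤ) → Fin M → ℤ
  T μ h v = ∑ (λ x → h (v ⊕ μ x))

  ‖_‖² : (Fin M → ℤ) → ℤ
  ‖ h ‖² = ∑ (λ v → h v ℤ.* h v)

  autocorrelation : (Fin M → ℤ) → Fin M → ℤ
  autocorrelation h w = ∑ (λ v → h v ℤ.* h (v ⊕ w))

  ‖‖²-cong : ∀ {g h} → g ≗ h → ‖ g ‖² ≡ ‖ h ‖²
  ‖‖²-cong g≗h = ∑-cong (λ v → cong₂ ℤ._*_ (g≗h v) (g≗h v))

  ‖‖²-nonneg : ∀ h → 0ℤ ℤ.≤ ‖ h ‖²
  ‖‖²-nonneg h = ∑-nonneg (λ v → sq-nonneg (h v))

  autocorrelation-𝟎 : ∀ h → autocorrelation h 𝟎 ≡ ‖ h ‖²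
  autocorrelation-𝟎 h = ∑-cong (λ v → cong (λ w → h v ℤ.* h w) (V.identityʳ v))

  T-cong : ∀ {k} {μ ν : Fin k → Fin M} {g h} → μ ≗ ν → g ≗ h → T μ g ≗ T ν h
  T-cong {h = h} μ≗ν g≗h v = ∑-cong (λ x → ≡.trans (g≗h _) (cong (λ w → h (v ⊕ w)) (μ≗ν x)))

  T-swap : ∀ {k l} (μ : Fin k → Fin M) (ν : Fin l → Fin M) h → T μ (T ν h) ≗ T ν (T μ h)
  T-swap μ ν h v = ≡.trans (∑-swap (λ x y → h ((v ⊕ μ x) ⊕ ν y)))
    (∑-cong (λ y → ∑-cong (λ x → cong h (
      ≡.trans (V.assoc v (μ x) (ν y)) (≡.trans (cong (v ⊕_) (V.comm (μ x) (ν y))) (≡.sym (V.assoc v (ν y) (μ x))))))))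

  -- Expand the square and translate `v` by `μ x`: the two shifts then matter only through their
  -- difference. This identity takes the place of a Fourier expansion.
  ‖T‖² : ∀ {k} (μ : Fin k → Fin M) h →
    ‖ T μ h ‖² ≡ ∑ (λ x → ∑ (λ y → autocorrelation h (μ y ⊖ μ x)))
  ‖T‖² μ h = begin
    ∑ (λ v → T μ h v ℤ.* T μ h v)
      ≡⟨ ∑-cong (λ v → ∑-product (λ x → h (v ⊕ μ x)) (λ y → h (v ⊕ μ y))) ⟩
    ∑ (λ v → ∑ (λ x → ∑ (λ y → h (v ⊕ μ x) ℤ.* h (v ⊕ μ y))))
      ≡⟨ ∑-swap (λ v x → ∑ (λ y → h (v ⊕ μ x) ℤ.* h (v ⊕ μ y))) ⟩
    ∑ (λ x → ∑ (λ v → ∑ (λ y → h (v ⊕ μ x) ℤ.* h (v ⊕ μ y))))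
      ≡⟨ ∑-cong (λ x → ∑-swap (λ v y → h (v ⊕ μ x) ℤ.* h (v ⊕ μ y))) ⟩
    ∑ (λ x → ∑ (λ y → ∑ (λ v → h (v ⊕ μ x) ℤ.* h (v ⊕ μ y))))
      ≡⟨ ∑-cong (λ x → ∑-cong (λ y → ∑-cong (λ v → cong (λ w → h (v ⊕ μ x) ℤ.* h w) (shift v (μ x) (μ y))))) ⟩
    ∑ (λ x → ∑ (λ y → ∑ (λ v → h (v ⊕ μ x) ℤ.* h ((v ⊕ μ x) ⊕ (μ y ⊖ μ x)))))
      ≡⟨ ∑-cong (λ x → ∑-cong (λ y → ∑-translate (λ v → h v ℤ.* h (v ⊕ (μ y ⊖ μ x))) (μ x))) ⟩
    ∑ (λ x → ∑ (λ y → autocorrelation h (μ y ⊖ μ x))) ∎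
    where
    open ≡.≡-Reasoning
    shift : ∀ v a b → v ⊕ b ≡ (v ⊕ a) ⊕ (b ⊖ a)
    shift v a b = ≡.sym (≡.trans (V.assoc v a _) (cong (v ⊕_)
      (≡.trans (V.comm a _) (cancel-⊖ a b))))

-- Sums over a finite field

module FieldSums {a ℓ} (F : FiniteField a ℓ) where
  open FiniteField F hiding (refl; zero)
  open Inverse enumeration public using (to; from; to-cong)
  open Algebra.Properties.Group +-group public using (//-rightDividesˡ; //-rightDividesʳ; x∙y⁻¹≈ε⇒x≈y)

  to-from : ∀ k → to (from k) ≡ k
  to-from = Inverse.strictlyInverseˡ enumeration

  from-to : ∀ x → from (to x) ≈ x
  from-to = Inverse.strictlyInverseʳ enumeration

  to-injective : ∀ {x y} → to x ≡ to y → x ≈ y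
  to-injective {x} {y} eq = trans (sym (from-to x)) (trans (reflexive (cong from eq)) (from-to y))

  from-injective : ∀ {j k} → from j ≈ from k → j ≡ k
  from-injective {j} {k} eq = ≡.trans (≡.sym (to-from j)) (≡.trans (to-cong eq) (to-from k))

  2≤q : 2 ℕ.≤ q
  2≤q = Fin.injective⇒≤ {f = two} two-injective
    where
    two : Fin 2 → Fin q
    two zero    = to 0#
    two (suc _) = to 1#
    two-injective : ∀ {i j} → two i ≡ two j → i ≡ j
    two-injective {zero}     {zero}     _  = refl
    two-injective {zero}     {suc _}    eq = contradiction (to-injective eq) 0≉1
    two-injective {suc _}    {zero}     eq = contradiction (to-injective (≡.sym eq)) 0≉1
    two-injective {suc zero} {suc zero} _  = refl

  δ : ∀ {k} → Fin k → Vector Carrier k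
  δ i j with j Fin.≟ i
  ... | yes _ = 1#
  ... | no  _ = 0#

  δ-≡ : ∀ {k} (i : Fin k) → δ i i ≈ 1#
  δ-≡ i with i Fin.≟ i
  ... | yes _   = reflexive refl
  ... | no  i≢i = contradiction refl i≢i

  δ-≢ : ∀ {k} {i j : Fin k} → j ≢ i → δ i j ≈ 0#
  δ-≢ {i = i} {j} j≢i with j Fin.≟ i
  ... | yes j≡i = contradiction j≡i j≢i
  ... | no  _   = reflexive refl

  sum-δ : ∀ {k} (i : Fin k) (f : Vector Carrier k) → sum (λ j → δ i j * f j) ≈ f i
  sum-δ i f = trans (sum-single +-commutativeMonoid i (λ j → δ i j * f j) (λ j j≢i → trans (*-congʳ (δ-≢ j≢i)) (zeroˡ (f j))))
    (trans (*-congʳ (δ-≡ i)) (*-identityˡ (f i)))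

  Congruent : (Carrier → ℤ) → Set _
  Congruent g = ∀ {x y} → x ≈ y → g x ≡ g y

  ∑-reindex : ∀ (g : Carrier → ℤ) → Congruent g → (φ ψ : Carrier → Carrier) →
    (∀ {x y} → x ≈ y → φ x ≈ φ y) → (∀ {x y} → x ≈ y → ψ x ≈ ψ y) →
    (∀ x → φ (ψ x) ≈ x) → (∀ x → ψ (φ x) ≈ x) →
    ∑ (λ k → g (φ (from k))) ≡ ∑ (λ k → g (from k))
  ∑-reindex g g-cong φ ψ φ-cong ψ-cong φψ ψφ = ≡.sym (≡.trans
    (∑-permute (λ k → g (from k)) (permutation (λ k → to (φ (from k))) (λ k → to (ψ (from k)))
      (λ k → ≡.trans (to-cong (trans (φ-cong (from-to _)) (φψ _))) (to-from k))
      (λ k → ≡.trans (to-cong (trans (ψ-cong (from-to _)) (ψφ _))) (to-from k))))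
    (∑-cong (λ k → g-cong (from-to _))))

  ∑-scale : ∀ (g : Carrier → ℤ) → Congruent g → ∀ {a} → ¬ (a ≈ 0#) →
    ∑ (λ k → g (a * from k)) ≡ ∑ (λ k → g (from k))
  ∑-scale g g-cong {a} a≉0 = let (a⁻¹ , a⁻¹*a≈1 , a*a⁻¹≈1) = ≉0⇒invertible a≉0 in
    ∑-reindex g g-cong (a *_) (a⁻¹ *_) *-congˡ *-congˡ
      (λ x → trans (sym (*-assoc _ _ x)) (trans (*-congʳ a*a⁻¹≈1) (*-identityˡ x)))
      (λ x → trans (sym (*-assoc _ _ x)) (trans (*-congʳ a⁻¹*a≈1) (*-identityˡ x)))

  ∑-shift : ∀ (g : Carrier → ℤ) → Congruent g → ∀ a →
    ∑ (λ k → g (from k - a)) ≡ ∑ (λ k → g (from k))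
  ∑-shift g g-cong a = ∑-reindex g g-cong (_- a) (_+ a) +-congʳ +-congʳ
    (//-rightDividesʳ a) (//-rightDividesˡ a)

  -- Averages over `d`-th powers along a line

  module _ {M : ℕ} (_⊕_ : Fin M → Fin M → Fin M) (𝟎 : Fin M) (⊖_ : Fin M → Fin M)
    (isAbelianGroup : IsAbelianGroup _≡_ _⊕_ 𝟎 ⊖_) where

    open Translations _⊕_ 𝟎 ⊖_ isAbelianGroup
    private module V = IsAbelianGroup isAbelianGroup

    -- `ι` is an additive homomorphism into the group; in the application it sends `s` to `s` times
    -- a fixed column of the matrix.
    module Line (ι : Carrier → Fin M)
      (ι-cong : ∀ {x y} → x ≈ y → ι x ≡ ι y) (ι-+ : ∀ x y → ι (x + y) ≡ ι x ⊕ ι y)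
      where

      ι-- : ∀ x y → ι (x - y) ≡ ι x ⊖ ι y
      ι-- x y = begin
        ι (x - y)                ≡⟨ cancel-⊕ (ι y) (ι (x - y)) ⟨
        (ι (x - y) ⊕ ι y) ⊖ ι y  ≡⟨ cong (_⊖ ι y) (ι-+ (x - y) y) ⟨
        ι ((x - y) + y) ⊖ ι y    ≡⟨ cong (_⊖ ι y) (ι-cong (//-rightDividesˡ y x)) ⟩
        ι x ⊖ ι y                ∎
        where open ≡.≡-Reasoning

      ι-0 : ι 0# ≡ 𝟎
      ι-0 = ≡.trans (ι-cong (sym (-‿inverseʳ 0#))) (≡.trans (ι-- 0# 0#) (V.inverseʳ _))

      -- Averaging the operators T (λ y → ι (u * y ^ d)) over all u makes them
      -- computable; those with u a nonzero d-th power all have the same norm, and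
      -- each u is a d-th power in at most d ways.
      module _ (d : ℕ) (d-roots : ∀ j → ∑ (λ k → indicator (to (from k ^ d) Fin.≟ j)) ℤ.≤ + d)
        (h : Fin M → ℤ) where

        private
          open import Algebra.Properties.CommutativeSemiring.Exp commutativeSemiring using (^-congˡ; ^-distrib-*)
          open import Algebra.Properties.Ring ring using (-‿distribʳ-*)

          c₀ W : ℤ
          c : Carrier → ℤ
          c s = autocorrelation h (ι s)
          c₀ = ‖ h ‖²
          W = ∑ (λ k → c (from k))

          c-cong : Congruent c
          c-cong x≈y = cong (autocorrelation h) (ι-cong x≈y)

          c-0 : c 0# ≡ c₀
          c-0 = ≡.trans (cong (autocorrelation h) ι-0) (autocorrelation-𝟎 h)

          μ : Carrier → Fin q → Fin M
          μ u k = ι (u * from k ^ d)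

          Q : Carrier → ℤ
          Q u = ‖ T (μ u) h ‖²

          Q-cong : Congruent Q
          Q-cong x≈y = ‖‖²-cong (T-cong {g = h} (λ k → ι-cong (*-congʳ x≈y)) (λ _ → refl))

          Q-nonneg : ∀ u → 0ℤ ℤ.≤ Q u
          Q-nonneg u = ‖‖²-nonneg (T (μ u) h)

          -- Since `z ^ d * y ^ d = (z * y) ^ d` and multiplication by `z` permutes the field, both
          -- operators sum the same translates.
          Q-power : ∀ {z} → ¬ (z ≈ 0#) → Q (z ^ d) ≡ Q 1#
          Q-power {z} z≉0 = ‖‖²-cong λ v → ≡.trans
            (∑-cong (λ k → cong (λ w → h (v ⊕ w)) (ι-cong (trans (sym (^-distrib-* z (from k) d)) (sym (*-identityˡ _))))))
            (∑-scale (λ y → h (v ⊕ ι (1# * y ^ d)))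
              (λ x≈y → cong (λ w → h (v ⊕ w)) (ι-cong (*-congˡ (^-congˡ d x≈y)))) z≉0)

          -- For each fixed `x` the difference `y - x` runs once through the field, which gives `q`
          -- copies of `W`. In particular `W` is nonnegative, although single autocorrelations need
          -- not be.
          qW : ‖ T (ι ∘ from) h ‖² ≡ + q ℤ.* W
          qW = begin
            ‖ T (ι ∘ from) h ‖²
              ≡⟨ ‖T‖² (ι ∘ from) h ⟩
            ∑ (λ x → ∑ (λ y → autocorrelation h (ι (from y) ⊖ ι (from x))))
              ≡⟨ ∑-cong (λ x → ∑-cong (λ y → cong (autocorrelation h) (ι-- (from y) (from x)))) ⟨
            ∑ (λ x → ∑ (λ y → c (from y - from x)))
              ≡⟨ ∑-cong (λ x → ∑-shift c c-cong (from x)) ⟩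
            ∑ {q} (λ x → W)
              ≡⟨ ∑-const q W ⟩
            + q ℤ.* W ∎
            where open ≡.≡-Reasoning

          instance
            q-positive : ℤ.Positive (+ q)
            q-positive = ℤ.positive (ℤ.+<+ (ℕ.≤-trans (ℕ.s≤s ℕ.z≤n) 2≤q))

          W-nonneg : 0ℤ ℤ.≤ W
          W-nonneg = ℤ.*-cancelˡ-≤-pos 0ℤ W (+ q)
            (≡.subst₂ ℤ._≤_ (≡.sym (ℤ.*-zeroʳ (+ q))) qW (‖‖²-nonneg (T (ι ∘ from) h)))

          hit : Fin q → Fin q → ℤ
          hit x y = indicator (to (from y ^ d) Fin.≟ to (from x ^ d))

          -- If the two powers agree, every term is `c₀`, and adding `W ≥ 0` only weakens the bound.
          -- Otherwise their difference is invertible, so its multiples by `u` run once through the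
          -- field and the sum is exactly `W`.
          ∑u : ∀ x y → ∑ (λ u → c (from u * (from y ^ d - from x ^ d))) ℤ.≤
                       hit x y ℤ.* (+ q ℤ.* c₀) ℤ.+ W
          ∑u x y with to (from y ^ d) Fin.≟ to (from x ^ d)
          ... | yes eq = begin
            ∑ (λ u → c (from u * (from y ^ d - from x ^ d)))
              ≡⟨ ∑-cong (λ u → ≡.trans
                   (c-cong (trans (*-congˡ (trans (+-congʳ (to-injective eq)) (-‿inverseʳ _))) (zeroʳ _))) c-0) ⟩
            ∑ {q} (λ _ → c₀)  ≡⟨ ∑-const q c₀ ⟩
            + q ℤ.* c₀        ≡⟨ ℤ.+-identityʳ _ ⟨
            + q ℤ.* c₀ ℤ.+ 0ℤ ≤⟨ ℤ.+-monoʳ-≤ (+ q ℤ.* c₀) W-nonneg ⟩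
            + q ℤ.* c₀ ℤ.+ W  ≡⟨ cong (λ z → z ℤ.+ W) (ℤ.*-identityˡ (+ q ℤ.* c₀)) ⟨
            1ℤ ℤ.* (+ q ℤ.* c₀) ℤ.+ W ∎
            where open ℤ.≤-Reasoning
          ... | no neq = ℤ.≤-reflexive (≡.trans
            (≡.trans (∑-cong (λ u → c-cong (*-comm _ _))) (∑-scale c c-cong Δ≉0))
            (≡.sym (≡.trans (cong (λ z → z ℤ.+ W) (ℤ.*-zeroˡ (+ q ℤ.* c₀))) (ℤ.+-identityˡ W))))
            where
            Δ≉0 : ¬ (from y ^ d - from x ^ d ≈ 0#)
            Δ≉0 Δ≈0 = neq (to-cong (x∙y⁻¹≈ε⇒x≈y _ _ Δ≈0))

          -- Bring the sum over `u` innermost and apply `∑u`; for each `x` at most `d` values of `y`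
          -- have the same `d`-th power.
          ∑Q : ∑ (λ u → Q (from u)) ℤ.≤ + q ℤ.* (+ d ℤ.* (+ q ℤ.* c₀) ℤ.+ + q ℤ.* W)
          ∑Q = begin
            ∑ (λ u → Q (from u))
              ≡⟨ ∑-cong (λ u → ‖T‖² (μ (from u)) h) ⟩
            ∑ (λ u → ∑ (λ x → ∑ (λ y → autocorrelation h (μ (from u) y ⊖ μ (from u) x))))
              ≡⟨ ∑-cong (λ u → ∑-cong (λ x → ∑-cong (λ y → cong (autocorrelation h)
                   (≡.trans (≡.sym (ι-- _ _)) (ι-cong (sym (trans (distribˡ _ _ _) (+-congˡ (sym (-‿distribʳ-* _ _)))))))))) ⟩
            ∑ (λ u → ∑ (λ x → ∑ (λ y → c (from u * (from y ^ d - from x ^ d)))))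
              ≡⟨ ∑-swap (λ u x → ∑ (λ y → c (from u * (from y ^ d - from x ^ d)))) ⟩
            ∑ (λ x → ∑ (λ u → ∑ (λ y → c (from u * (from y ^ d - from x ^ d)))))
              ≡⟨ ∑-cong (λ x → ∑-swap (λ u y → c (from u * (from y ^ d - from x ^ d)))) ⟩
            ∑ (λ x → ∑ (λ y → ∑ (λ u → c (from u * (from y ^ d - from x ^ d)))))
              ≤⟨ ∑-mono (λ x → ∑-mono (∑u x)) ⟩
            ∑ (λ x → ∑ (λ y → hit x y ℤ.* (+ q ℤ.* c₀) ℤ.+ W))
              ≡⟨ ∑-cong (λ x → ≡.trans (∑-+ (λ y → hit x y ℤ.* (+ q ℤ.* c₀)) (λ _ → W))
                   (cong₂ ℤ._+_ (≡.sym (∑-* (+ q ℤ.* c₀) (hit x))) (∑-const q W))) ⟩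
            ∑ (λ x → ∑ (hit x) ℤ.* (+ q ℤ.* c₀) ℤ.+ + q ℤ.* W)
              ≤⟨ ∑-mono (λ x → ℤ.+-monoˡ-≤ (+ q ℤ.* W) (ℤ.*-monoʳ-≤-nonNeg (+ q ℤ.* c₀) {{ℤ.nonNegative qc₀-nonneg}}
                   (d-roots (to (from x ^ d))))) ⟩
            ∑ {q} (λ x → + d ℤ.* (+ q ℤ.* c₀) ℤ.+ + q ℤ.* W)
              ≡⟨ ∑-const q _ ⟩
            + q ℤ.* (+ d ℤ.* (+ q ℤ.* c₀) ℤ.+ + q ℤ.* W) ∎
            where
            open ℤ.≤-Reasoning
            qc₀-nonneg : 0ℤ ℤ.≤ + q ℤ.* c₀
            qc₀-nonneg = ≡.subst (ℤ._≤ + q ℤ.* c₀) (ℤ.*-zeroʳ (+ q)) (ℤ.*-monoˡ-≤-nonNeg (+ q) (‖‖²-nonneg h))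

          -- Every nonzero `z` contributes exactly `Q 1#`, by `Q-power`. The extra `Q 1#` on the
          -- right makes up for `z = 0`.
          lower : + q ℤ.* Q 1# ℤ.≤ ∑ (λ z → Q (from z ^ d)) ℤ.+ Q 1#
          lower = begin
            + q ℤ.* Q 1#      ≡⟨ ∑-const q (Q 1#) ⟨
            ∑ {q} (λ _ → Q 1#)  ≤⟨ ∑-mono pointwise ⟩
            ∑ (λ z → Q (from z ^ d) ℤ.+ indicator (to 0# Fin.≟ z) ℤ.* Q 1#)
              ≡⟨ ∑-+ (λ z → Q (from z ^ d)) _ ⟩
            ∑ (λ z → Q (from z ^ d)) ℤ.+ ∑ (λ z → indicator (to 0# Fin.≟ z) ℤ.* Q 1#)
              ≡⟨ cong (λ s → ∑ (λ z → Q (from z ^ d)) ℤ.+ s) (∑-indicator (to 0#) (λ _ → Q 1#)) ⟩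
            ∑ (λ z → Q (from z ^ d)) ℤ.+ Q 1# ∎
            where
            open ℤ.≤-Reasoning
            pointwise : ∀ z → Q 1# ℤ.≤ Q (from z ^ d) ℤ.+ indicator (to 0# Fin.≟ z) ℤ.* Q 1#
            pointwise z with to 0# Fin.≟ z
            ... | yes _ = begin
              Q 1#                                ≡⟨ ℤ.+-identityˡ _ ⟨
              0ℤ ℤ.+ Q 1#                         ≤⟨ ℤ.+-monoˡ-≤ (Q 1#) (Q-nonneg (from z ^ d)) ⟩
              Q (from z ^ d) ℤ.+ Q 1#             ≡⟨ cong (λ s → Q (from z ^ d) ℤ.+ s) (ℤ.*-identityˡ (Q 1#)) ⟨
              Q (from z ^ d) ℤ.+ 1ℤ ℤ.* Q 1#      ∎
            ... | no z≢0 = ℤ.≤-reflexive (≡.sym (≡.trans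
                (cong (λ s → Q (from z ^ d) ℤ.+ s) (ℤ.*-zeroˡ (Q 1#)))
                (≡.trans (ℤ.+-identityʳ _) (Q-power (λ z≈0 → z≢0 (≡.trans (to-cong (sym z≈0)) (to-from z)))))))

          -- Each `u` occurs as a `d`-th power at most `d` times, and the values of `Q` are
          -- nonnegative.
          upper : ∑ (λ z → Q (from z ^ d)) ℤ.≤ + d ℤ.* ∑ (λ u → Q (from u))
          upper = ≡.subst (ℤ._≤ + d ℤ.* ∑ (λ u → Q (from u))) (∑-cong (λ z → Q-cong (from-to (from z ^ d))))
            (∑-fibres-≤ (λ z → to (from z ^ d)) (λ u → Q (from u)) (λ u → Q-nonneg (from u)) d-roots)

        ‖T-power‖² : ‖ T (λ k → ι (from k ^ d)) h ‖² ℤ.≤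
          + 2 ℤ.* (+ d ℤ.* (+ d ℤ.* (+ q ℤ.* ‖ h ‖²) ℤ.+ ‖ T (ι ∘ from) h ‖²))
        ‖T-power‖² = ≡.subst (ℤ._≤ _) (‖‖²-cong (T-cong {g = h} (λ k → ι-cong (*-identityˡ _)) (λ _ → refl)))
          (ℤ.*-cancelˡ-≤-pos (Q 1#) _ (+ q) goal)
          where
          open ℤ.≤-Reasoning
          B X Σ : ℤ
          B = ‖ T (ι ∘ from) h ‖²
          X = + d ℤ.* (+ d ℤ.* (+ q ℤ.* c₀) ℤ.+ B)
          Σ = ∑ (λ z → Q (from z ^ d))
          Σ≤qX : Σ ℤ.≤ + q ℤ.* X
          Σ≤qX = begin
            Σ                              ≤⟨ upper ⟩
            + d ℤ.* ∑ (λ u → Q (from u))   ≤⟨ ℤ.*-monoˡ-≤-nonNeg (+ d) ∑Q ⟩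
            + d ℤ.* (+ q ℤ.* (+ d ℤ.* (+ q ℤ.* c₀) ℤ.+ + q ℤ.* W))
              ≡⟨ cong (λ z → + d ℤ.* (+ q ℤ.* (+ d ℤ.* (+ q ℤ.* c₀) ℤ.+ z))) qW ⟨
            + d ℤ.* (+ q ℤ.* (+ d ℤ.* (+ q ℤ.* c₀) ℤ.+ B))
              ≡⟨ swap (+ d) (+ q) _ ⟩
            + q ℤ.* X ∎
            where
            swap : ∀ x y z → x ℤ.* (y ℤ.* z) ≡ y ℤ.* (x ℤ.* z)
            swap = solve-∀
          -- The lower bound amounts to `(q - 1) * Q 1# ≤ Σ`. As `q ≥ 2`, doubling it yields
          -- `q * Q 1# ≤ 2 * Σ`, which is the source of the factor 2.
          goal : + q ℤ.* Q 1# ℤ.≤ + q ℤ.* (+ 2 ℤ.* X)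
          goal = ℤ+-cancelˡ-≤ (+ 2 ℤ.* Q 1#) _ _ (begin
            + 2 ℤ.* Q 1# ℤ.+ + q ℤ.* Q 1#
              ≤⟨ ℤ.+-monoˡ-≤ (+ q ℤ.* Q 1#) (ℤ.*-monoʳ-≤-nonNeg (Q 1#) {{ℤ.nonNegative (Q-nonneg 1#)}} (ℤ.+≤+ 2≤q)) ⟩
            + q ℤ.* Q 1# ℤ.+ + q ℤ.* Q 1#
              ≤⟨ ℤ.+-mono-≤ lower lower ⟩
            (Σ ℤ.+ Q 1#) ℤ.+ (Σ ℤ.+ Q 1#)
              ≡⟨ collect Σ (Q 1#) ⟩
            + 2 ℤ.* Q 1# ℤ.+ + 2 ℤ.* Σ
              ≤⟨ ℤ.+-monoʳ-≤ (+ 2 ℤ.* Q 1#) (ℤ.*-monoˡ-≤-nonNeg (+ 2) Σ≤qX) ⟩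
            + 2 ℤ.* Q 1# ℤ.+ + 2 ℤ.* (+ q ℤ.* X)
              ≡⟨ cong (λ z → + 2 ℤ.* Q 1# ℤ.+ z) (swap (+ q) X) ⟩
            + 2 ℤ.* Q 1# ℤ.+ + q ℤ.* (+ 2 ℤ.* X) ∎)
            where
            collect : ∀ s y → (s ℤ.+ y) ℤ.+ (s ℤ.+ y) ≡ + 2 ℤ.* y ℤ.+ + 2 ℤ.* s
            collect = solve-∀
            swap : ∀ x y → + 2 ℤ.* (x ℤ.* y) ≡ x ℤ.* (+ 2 ℤ.* y)
            swap = solve-∀

-- Systems xᵢ ^ eᵢ = (polynomial of degree below eᵢ)

-- The exponent vector of the monomial `x i ^ k`.
unit : ∀ {n} → Fin n → ℕ → Vector ℕ n
unit i k j with j Fin.≟ i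
... | yes _ = k
... | no  _ = 0

unit-≡ : ∀ {n} (i : Fin n) k → unit i k i ≡ k
unit-≡ i k with i Fin.≟ i
... | yes _   = refl
... | no  i≢i = contradiction refl i≢i

unit-≢ : ∀ {n} {i j : Fin n} k → j ≢ i → unit i k j ≡ 0
unit-≢ {i = i} {j} k j≢i with j Fin.≟ i
... | yes j≡i = contradiction j≡i j≢i
... | no  _   = refl

_⊞_ : ∀ {n} → Vector ℕ n → Vector ℕ n → Vector ℕ n
(α ⊞ β) i = α i ℕ.+ β i

sumℕ-⊞ : ∀ {n} (α β : Vector ℕ n) → sumℕ (α ⊞ β) ≡ sumℕ α ℕ.+ sumℕ β
sumℕ-⊞ = Algebra.Properties.CommutativeMonoid.Sum.∑-distrib-+ ℕ.+-0-commutativeMonoid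

sumℕ-unit : ∀ {n} (i : Fin n) k → sumℕ (unit i k) ≡ k
sumℕ-unit i k = ≡.trans (sum-single ℕ.+-0-commutativeMonoid i (unit i k) (λ j → unit-≢ k)) (unit-≡ i k)

sumℕ-cong : ∀ {n} {α β : Vector ℕ n} → α ≗ β → sumℕ α ≡ sumℕ β
sumℕ-cong = Algebra.Properties.CommutativeMonoid.Sum.sum-cong-≗ ℕ.+-0-commutativeMonoid

-- Junk unless k ≤ α i.
lower : ∀ {n} → Vector ℕ n → Fin n → ℕ → Vector ℕ n
lower α i k j = α j ∸ unit i k j

lower-⊞-unit : ∀ {n} (α : Vector ℕ n) i {k} → k ≤ α i → (lower α i k ⊞ unit i k) ≗ α
lower-⊞-unit α i {k} k≤αi j with j Fin.≟ i
... | yes refl = ℕ.m∸n+n≡m k≤αi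
... | no  _    = ℕ.+-identityʳ (α j)

funToFin-cong : ∀ {m n} {f g : Fin m → Fin n} → f ≗ g → funToFin f ≡ funToFin g
funToFin-cong {zero}  f≗g = refl
funToFin-cong {suc m} f≗g = cong₂ combine (f≗g zero) (funToFin-cong (f≗g ∘ suc))

funToFin-injective : ∀ {m n} {f g : Fin m → Fin n} → funToFin f ≡ funToFin g → f ≗ g
funToFin-injective {f = f} {g} eq i = ≡.trans (≡.sym (Fin.finToFun-funToFin f i))
  (≡.trans (cong (λ k → finToFun k i) eq) (Fin.finToFun-funToFin g i))

finToFun-injective : ∀ {m n} {j k : Fin (m ℕ.^ n)} → finToFun {m} {n} j ≗ finToFun k → j ≡ k
finToFun-injective {m} {n} {j} {k} eq = ≡.trans (≡.sym (Fin.funToFin-finToFin {n} {m} j))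
  (≡.trans (funToFin-cong eq) (Fin.funToFin-finToFin {n} {m} k))

enumerate : ∀ {N p} {P : Pred (Fin N) p} (P? : Decidable P) →
  ∃[ K ] Σ[ z ∈ (Fin K → Fin N) ] Injective _≡_ _≡_ z × (∀ k → P (z k)) × ∑ (λ i → indicator (P? i)) ≡ + K
enumerate {zero}  P? = 0 , (λ ()) , (λ { {()} }) , (λ ()) , ∑-empty _
enumerate {suc N} {P = P} P? with enumerate (P? ∘ suc) | P? zero in eq
... | K , z , z-inj , Pz , count | yes P0 = suc K , z′ , z′-inj , Pz′ ,
    ≡.trans (∑-suc _) (≡.trans (cong₂ ℤ._+_ (cong indicator eq) count) refl)
  where
  z′ : Fin (suc K) → Fin (suc N)
  z′ zero    = zero
  z′ (suc k) = suc (z k)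
  z′-inj : Injective _≡_ _≡_ z′
  z′-inj {zero}  {zero}  _ = refl
  z′-inj {suc _} {suc _} e = cong suc (z-inj (Fin.suc-injective e))
  Pz′ : ∀ k → P (z′ k)
  Pz′ zero    = P0
  Pz′ (suc k) = Pz k
... | K , z , z-inj , Pz , count | no _ = K , suc ∘ z , z-inj ∘ Fin.suc-injective , Pz ,
    ≡.trans (∑-suc _) (≡.trans (cong₂ ℤ._+_ (cong indicator eq) count) (ℤ.+-identityˡ _))

-- Turns a bound on the length of every list of distinct solutions into a bound on an indicator sum;
-- the first form suits the dimension argument below.
count-≤ : ∀ {N p} {P : Pred (Fin N) p} (P? : Decidable P) {D} →
  (∀ {K} (z : Fin K → Fin N) → Injective _≡_ _≡_ z → (∀ k → P (z k)) → K ≤ D) →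
  ∑ (λ i → indicator (P? i)) ℤ.≤ + D
count-≤ P? bound with enumerate P?
... | K , z , z-inj , Pz , count = ≡.subst (ℤ._≤ _) (≡.sym count) (ℤ.+≤+ (bound z z-inj Pz))

module Bezout {a ℓ} (F : FiniteField a ℓ) where
  open FiniteField F hiding (refl; zero)
  open FieldSums F
  open import Algebra.Properties.Semiring.Exp semiring using (^-homo-*; ^-congʳ)
  private
    module Σ = Algebra.Properties.CommutativeMonoid.Sum +-commutativeMonoid
    module Π = Algebra.Properties.CommutativeMonoid.Sum *-commutativeMonoid
  open import Algebra.Properties.Semiring.Sum semiring using (*-distribˡ-sum; *-distribʳ-sum)
  import Relation.Binary.Reasoning.Setoid setoid as ≈-Reasoning

  *-nonzero : ∀ {x y} → ¬ (x ≈ 0#) → ¬ (y ≈ 0#) → ¬ (x * y ≈ 0#)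
  *-nonzero {x} {y} x≉0 y≉0 xy≈0 = let (x⁻¹ , x⁻¹*x≈1 , _) = ≉0⇒invertible x≉0 in
    y≉0 (trans (sym (*-identityˡ y)) (trans (*-congʳ (sym x⁻¹*x≈1))
      (trans (*-assoc x⁻¹ x y) (trans (*-congˡ xy≈0) (zeroʳ x⁻¹)))))

  monomial : ∀ {n} → Vector ℕ n → Vector Carrier n → Carrier
  monomial α x = product (λ i → x i ^ α i)

  monomial-⊞ : ∀ {n} (α β : Vector ℕ n) x → monomial (α ⊞ β) x ≈ monomial α x * monomial β x
  monomial-⊞ α β x = trans (Π.sum-cong-≋ (λ i → ^-homo-* (x i) (α i) (β i)))
    (Π.∑-distrib-+ (λ i → x i ^ α i) (λ i → x i ^ β i))

  monomial-unit : ∀ {n} (i : Fin n) k x → monomial (unit i k) x ≈ x i ^ k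
  monomial-unit i k x = trans
    (sum-single *-commutativeMonoid i (λ j → x j ^ unit i k j) (λ j j≢i → ^-congʳ (x j) (unit-≢ k j≢i)))
    (^-congʳ (x i) (unit-≡ i k))

  monomial-cong : ∀ {n} {α β : Vector ℕ n} x → α ≗ β → monomial α x ≈ monomial β x
  monomial-cong x α≗β = Π.sum-cong-≋ (λ i → ^-congʳ (x i) (α≗β i))

  -- The functions on the solution set are all polynomial, hence by the equations
  -- combinations of the D ^ n monomials with exponents below D.  Comparing the
  -- number q ^ K of functions with the number of combinations bounds K.
  module _ {n r : ℕ} (e : Vector ℕ n) (D : ℕ) (e≤D : ∀ i → e i ≤ D) (0<e : ∀ i → 0 < e i)
    (m : Fin r → Vector ℕ n) (m<e : ∀ j i → sumℕ (m j) < e i)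
    (κ : Fin n → Fin r → Carrier) (β : Vector Carrier n)
    {K : ℕ} (Z : Fin K → Vector Carrier n) (Z-distinct : ∀ {k l} → (∀ i → Z k i ≈ Z l i) → k ≡ l)
    (solution : ∀ k i → Z k i ^ e i ≈ β i + sum (λ j → κ i j * monomial (m j) (Z k)))
    where

    private
      basis : Fin (D ℕ.^ n) → Fin K → Carrier
      basis b k = monomial (toℕ ∘ finToFun {D} {n} b) (Z k)

      Spanned : (Fin K → Carrier) → Set _
      Spanned f = Σ[ l ∈ (Fin (D ℕ.^ n) → Carrier) ] (∀ k → f k ≈ sum (λ b → l b * basis b k))

      resp : ∀ {f g} → (∀ k → g k ≈ f k) → Spanned f → Spanned g
      resp g≈f (l , eq) = l , λ k → trans (g≈f k) (eq k)

      add : ∀ {f g} → Spanned f → Spanned g → Spanned (λ k → f k + g k)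
      add (l , eq) (l′ , eq′) = (λ b → l b + l′ b) , λ k → trans (+-cong (eq k) (eq′ k))
        (sym (trans (Σ.sum-cong-≋ (λ b → distribʳ _ (l b) (l′ b))) (Σ.∑-distrib-+ (λ b → l b * basis b k) _)))

      scale : ∀ {f} x → Spanned f → Spanned (λ k → x * f k)
      scale x (l , eq) = (λ b → x * l b) , λ k → trans (*-congˡ (eq k))
        (trans (*-distribˡ-sum x (λ b → l b * basis b k)) (Σ.sum-cong-≋ (λ b → sym (*-assoc x (l b) _))))

      spanned-0 : Spanned (λ _ → 0#)
      spanned-0 = (λ _ → 0#) , λ k → sym (sum-zero +-commutativeMonoid _ (λ b → zeroˡ (basis b k)))

      spanned-sum : ∀ {s} (f : Fin s → Fin K → Carrier) → (∀ j → Spanned (f j)) → Spanned (λ k → sum (λ j → f j k))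
      spanned-sum {zero}  f sp = spanned-0
      spanned-sum {suc s} f sp = add (sp zero) (spanned-sum (f ∘ suc) (sp ∘ suc))

      spanned-reduced : ∀ α → (∀ i → α i < e i) → Spanned (λ k → monomial α (Z k))
      spanned-reduced α α<e = δ b₀ , λ k → sym (trans (sum-δ b₀ (λ b → basis b k)) (monomial-cong (Z k) (λ i →
          ≡.trans (cong toℕ (Fin.finToFun-funToFin αᶠ i)) (Fin.toℕ-fromℕ< _))))
        where
        αᶠ : Fin n → Fin D
        αᶠ i = Fin.fromℕ< (ℕ.<-≤-trans (α<e i) (e≤D i))
        b₀ : Fin (D ℕ.^ n)
        b₀ = funToFin αᶠ

      -- Split the factor `x i ^ e i` off the monomial and substitute the `i`-th equation for it.
      reduce : ∀ α i → e i ≤ α i → ∀ k → let α′ = lower α i (e i) in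
        monomial α (Z k) ≈ β i * monomial α′ (Z k) + sum (λ j → κ i j * monomial (m j ⊞ α′) (Z k))
      reduce α i eᵢ≤αᵢ k = begin
        monomial α (Z k)                              ≈⟨ monomial-cong (Z k) (lower-⊞-unit α i eᵢ≤αᵢ) ⟨
        monomial (α′ ⊞ unit i (e i)) (Z k)            ≈⟨ monomial-⊞ α′ (unit i (e i)) (Z k) ⟩
        monomial α′ (Z k) * monomial (unit i (e i)) (Z k)  ≈⟨ *-congˡ (trans (monomial-unit i (e i) (Z k)) (solution k i)) ⟩
        monomial α′ (Z k) * (β i + sum (λ j → κ i j * monomial (m j) (Z k)))  ≈⟨ *-comm _ _ ⟩
        (β i + sum (λ j → κ i j * monomial (m j) (Z k))) * monomial α′ (Z k)  ≈⟨ distribʳ _ _ _ ⟩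
        β i * monomial α′ (Z k) + sum (λ j → κ i j * monomial (m j) (Z k)) * monomial α′ (Z k)
          ≈⟨ +-congˡ (trans (*-distribʳ-sum _ (λ j → κ i j * monomial (m j) (Z k)))
               (Σ.sum-cong-≋ (λ j → trans (*-assoc (κ i j) _ _) (*-congˡ (sym (monomial-⊞ (m j) α′ (Z k))))))) ⟩
        β i * monomial α′ (Z k) + sum (λ j → κ i j * monomial (m j ⊞ α′) (Z k)) ∎
        where
        open ≈-Reasoning
        α′ = lower α i (e i)

      degree : ∀ α i → e i ≤ α i → sumℕ α ≡ e i ℕ.+ sumℕ (lower α i (e i))
      degree α i eᵢ≤αᵢ = ≡.trans (≡.sym (sumℕ-cong (lower-⊞-unit α i eᵢ≤αᵢ)))
        (≡.trans (sumℕ-⊞ (lower α i (e i)) _) (≡.trans (ℕ.+-comm (sumℕ (lower α i (e i))) _)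
          (cong (ℕ._+ sumℕ (lower α i (e i))) (sumℕ-unit i (e i)))))

      -- Induction on a strict bound `N` for the total degree. If some exponent reaches `e i`, both
      -- kinds of terms produced by `reduce` have smaller degree, because `0 < e i` and every `m j`
      -- has degree below `e i`; otherwise the monomial is already in the basis.
      spanned-monomial : ∀ N α → sumℕ α < N → Spanned (λ k → monomial α (Z k))
      spanned-monomial (suc N) α (ℕ.s≤s |α|≤N) with Fin.any? (λ i → e i ℕ.≤? α i)
      ... | no  none          = spanned-reduced α (λ i → ℕ.≰⇒> (λ le → none (i , le)))
      ... | yes (i , eᵢ≤αᵢ) = resp (reduce α i eᵢ≤αᵢ)
          (add (scale (β i) (spanned-monomial N α′ (ℕ.<-≤-trans (ℕ.m<n+m (sumℕ α′) (0<e i)) e+α′≤N)))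
            (spanned-sum _ (λ j → scale (κ i j) (spanned-monomial N (m j ⊞ α′)
              (ℕ.<-≤-trans (≡.subst (_< e i ℕ.+ sumℕ α′) (≡.sym (sumℕ-⊞ (m j) α′)) (ℕ.+-monoˡ-< (sumℕ α′) (m<e j i))) e+α′≤N)))))
        where
        α′ = lower α i (e i)
        e+α′≤N : e i ℕ.+ sumℕ α′ ≤ N
        e+α′≤N = ≡.subst (_≤ N) (degree α i eᵢ≤αᵢ) |α|≤N

      monomials : ∀ α → Spanned (λ k → monomial α (Z k))
      monomials α = spanned-monomial _ α ℕ.≤-refl

      -- Multiplication by a coordinate raises one exponent of each basis monomial; the result may
      -- leave the basis and is reduced again.
      coordinate : ∀ {f} i → Spanned f → Spanned (λ k → Z k i * f k)
      coordinate i (l , eq) = resp (λ k → trans (*-congˡ (eq k))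
          (trans (*-distribˡ-sum (Z k i) (λ b → l b * basis b k)) (Σ.sum-cong-≋ {D ℕ.^ n} (raise k))))
        (spanned-sum _ (λ b → scale (l b) (monomials (unit i 1 ⊞ exponents b))))
        where
        open ≈-Reasoning
        exponents : Fin (D ℕ.^ n) → Vector ℕ n
        exponents b = toℕ ∘ finToFun {D} {n} b
        raise : ∀ k b → Z k i * (l b * basis b k) ≈ l b * monomial (unit i 1 ⊞ exponents b) (Z k)
        raise k b = begin
          Z k i * (l b * basis b k)   ≈⟨ *-assoc _ _ _ ⟨
          Z k i * l b * basis b k     ≈⟨ *-congʳ (*-comm _ _) ⟩
          l b * Z k i * basis b k     ≈⟨ *-assoc _ _ _ ⟩
          l b * (Z k i * basis b k)
            ≈⟨ *-congˡ (*-congʳ (trans (monomial-unit i 1 (Z k)) (*-identityʳ _))) ⟨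
          l b * (monomial (unit i 1) (Z k) * basis b k)
            ≈⟨ *-congˡ (monomial-⊞ (unit i 1) (exponents b) (Z k)) ⟨
          l b * monomial (unit i 1 ⊞ exponents b) (Z k) ∎

      -- Interpolation. Starting from the constant monomial, each point `l₀` other than `k₀`
      -- contributes a factor `x i - Z l₀ i`, where `i` is a coordinate in which the two points
      -- differ. The product stays nonzero at `k₀` because a field has no zero divisors.
      separate : ∀ k₀ N → N ≤ K → ∃[ g ] Spanned g × ¬ (g k₀ ≈ 0#) ×
        (∀ l → toℕ l < N → l ≢ k₀ → g l ≈ 0#)
      separate k₀ zero    _   = (λ k → monomial (λ _ → 0) (Z k)) , monomials (λ _ → 0) ,
        (λ eq → 0≉1 (trans (sym eq) (sum-zero *-commutativeMonoid {n} _ (λ _ → reflexive refl)))) , λ _ ()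
      separate k₀ (suc N) N<K with separate k₀ N (ℕ.<⇒≤ N<K) | Fin.fromℕ< N<K Fin.≟ k₀
      ... | g , sp , g≉0 , g≈0 | yes l≡k₀ = g , sp , g≉0 , vanish
        where
        vanish : ∀ l → toℕ l < suc N → l ≢ k₀ → g l ≈ 0#
        vanish l (ℕ.s≤s l≤N) l≢k₀ with ℕ.m≤n⇒m<n∨m≡n l≤N
        ... | inj₁ l<N = g≈0 l l<N l≢k₀
        ... | inj₂ l≡N = contradiction (≡.trans (Fin.toℕ-injective (≡.trans l≡N (≡.sym (Fin.toℕ-fromℕ< N<K)))) l≡k₀) l≢k₀
      ... | g , sp , g≉0 , g≈0 | no l₀≢k₀ = g′ , sp′ , g′≉0 , vanish
        where
        l₀ = Fin.fromℕ< N<K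
        apart : ∃[ i ] ¬ (Z k₀ i ≈ Z l₀ i)
        apart = Fin.¬∀⟶∃¬ n _ (λ i → Z k₀ i ≟ Z l₀ i) (λ eq → l₀≢k₀ (≡.sym (Z-distinct eq)))
        i = proj₁ apart
        g′ : Fin K → Carrier
        g′ k = (Z k i - Z l₀ i) * g k
        sp′ : Spanned g′
        sp′ = resp (λ k → distribʳ (g k) _ _) (add (coordinate i sp) (scale (- Z l₀ i) sp))
        g′≉0 : ¬ (g′ k₀ ≈ 0#)
        g′≉0 = *-nonzero (λ eq → proj₂ apart (x∙y⁻¹≈ε⇒x≈y _ _ eq)) g≉0
        vanish : ∀ l → toℕ l < suc N → l ≢ k₀ → g′ l ≈ 0#
        vanish l (ℕ.s≤s l≤N) l≢k₀ with ℕ.m≤n⇒m<n∨m≡n l≤N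
        ... | inj₁ l<N = trans (*-congˡ (g≈0 l l<N l≢k₀)) (zeroʳ _)
        ... | inj₂ l≡N = trans (*-congʳ (trans (+-congʳ (reflexive (cong (λ z → Z z i) l≡l₀))) (-‿inverseʳ _))) (zeroˡ _)
          where l≡l₀ = Fin.toℕ-injective (≡.trans l≡N (≡.sym (Fin.toℕ-fromℕ< N<K)))

      -- Lagrange's formula: divide each separating function by its value at its own point and
      -- combine them with weights `f l`.
      spanned : ∀ f → Spanned f
      spanned f = resp (λ k → sym (trans
          (sum-single +-commutativeMonoid k _ (λ l l≢k → trans (*-congˡ (trans (*-congˡ
            (proj₂ (proj₂ (proj₂ (sep l))) k (Fin.toℕ<n k) (l≢k ∘ ≡.sym))) (zeroʳ _))) (zeroʳ _)))
          (trans (*-congˡ (proj₁ (proj₂ (inv k)))) (*-identityʳ (f k)))))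
        (spanned-sum _ (λ l → scale (f l) (scale (proj₁ (inv l)) (proj₁ (proj₂ (sep l))))))
        where
        sep : ∀ l → ∃[ g ] Spanned g × ¬ (g l ≈ 0#) × (∀ k → toℕ k < K → k ≢ l → g k ≈ 0#)
        sep l = separate l K ℕ.≤-refl
        inv : ∀ l → _
        inv l = ≉0⇒invertible (proj₁ (proj₂ (proj₂ (sep l))))

      coefficients : Fin (q ℕ.^ K) → Fin (q ℕ.^ (D ℕ.^ n))
      coefficients f = funToFin (to ∘ proj₁ (spanned (from ∘ finToFun f)))

      coefficients-injective : Injective _≡_ _≡_ coefficients
      coefficients-injective {f} {g} eq = finToFun-injective (λ k → from-injective (trans
        (proj₂ (spanned (from ∘ finToFun f)) k) (trans
        (Σ.sum-cong-≋ {D ℕ.^ n} (λ b → *-congʳ (to-injective (funToFin-injective eq b))))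
        (sym (proj₂ (spanned (from ∘ finToFun g)) k)))))

    #solutions-≤ : K ≤ D ℕ.^ n
    #solutions-≤ = ℕ.≮⇒≥ (λ Dⁿ<K → ℕ.<⇒≱ (ℕ.^-monoʳ-< q 2≤q Dⁿ<K) (Fin.injective⇒≤ coefficients-injective))

  -- The case of one variable and no monomials on the right: the equation is `x ^ d = from j`, and
  -- the bound `d ^ 1` equals `d`.
  #roots-≤ : ∀ {d} → 0 < d → ∀ j → ∑ (λ k → indicator (to (from k ^ d) Fin.≟ j)) ℤ.≤ + d
  #roots-≤ {d} 0<d j = count-≤ (λ k → to (from k ^ d) Fin.≟ j) (λ z z-inj eq → ≡.subst (_ ≤_) (ℕ.*-identityʳ d)
    (#solutions-≤ {1} {0} (λ _ → d) d (λ _ → ℕ.≤-refl) (λ _ → 0<d) (λ ()) (λ ()) (λ _ ()) (λ _ → from j)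
      (λ k _ → from (z k)) (λ eq → z-inj (from-injective (eq zero)))
      (λ k _ → trans (trans (sym (from-to _)) (reflexive (cong from (eq k)))) (sym (+-identityʳ _)))))

-- A missed value could be punched out of the codomain, leaving an injection into a smaller set.
injective⇒surjective : ∀ {n} {f : Fin n → Fin n} → Injective _≡_ _≡_ f → ∀ j → ∃[ i ] f i ≡ j
injective⇒surjective {suc n} {f} f-inj j with Fin.any? (λ i → f i Fin.≟ j)
... | yes hit  = hit
... | no  miss = contradiction
  (Fin.injective⇒≤ {f = λ i → Fin.punchOut (j≢f i)} (λ eq → f-inj (Fin.punchOut-injective (j≢f _) (j≢f _) eq)))
  ℕ.1+n≰n
  where
  j≢f : ∀ i → j ≢ f i
  j≢f i j≡fi = miss (i , ≡.sym j≡fi)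

-- Iterated averages and the deviation from uniformity

module IteratedTranslations {M : ℕ} (_⊕_ : Fin M → Fin M → Fin M) (𝟎 : Fin M) (⊖_ : Fin M → Fin M)
  (isAbelianGroup : IsAbelianGroup _≡_ _⊕_ 𝟎 ⊖_) where

  open Translations _⊕_ 𝟎 ⊖_ isAbelianGroup
  private module V = IsAbelianGroup isAbelianGroup

  total : ∀ {k} → Vector (Fin M) k → Fin M
  total = Vector.foldr _⊕_ 𝟎

  total-cong : ∀ {k} {v w : Vector (Fin M) k} → v ≗ w → total v ≡ total w
  total-cong {zero}  v≗w = refl
  total-cong {suc k} v≗w = cong₂ _⊕_ (v≗w zero) (total-cong (v≗w ∘ suc))

  -- The composite of the operators `T (μ i)`, written as one sum over all parameter vectors. This
  -- form matches both the count of solutions and the norm formula for injective families.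
  Op : ∀ {q k} → (Fin k → Fin q → Fin M) → (Fin M → ℤ) → Fin M → ℤ
  Op {q} {k} μ = T {q ℕ.^ k} (λ x → total (λ i → μ i (finToFun x i)))

  Op-zero : ∀ {q} (μ : Fin 0 → Fin q → Fin M) h → Op μ h ≗ h
  Op-zero μ h v = ≡.trans (∑-suc _) (≡.trans (cong (λ z → h (v ⊕ 𝟎) ℤ.+ z) (∑-empty _))
    (≡.trans (ℤ.+-identityʳ _) (cong h (V.identityʳ v))))

  Op-suc : ∀ {q k} (μ : Fin (suc k) → Fin q → Fin M) h → Op μ h ≗ T (μ zero) (Op (μ ∘ suc) h)
  Op-suc {q} {k} μ h v = ≡.trans
    (∑ᵛ-suc (λ x → h (v ⊕ total (λ i → μ i (x i))))
      (λ x≗y → cong (λ w → h (v ⊕ w)) (total-cong (λ i → cong (μ i) (x≗y i)))))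
    (∑-cong λ s → ∑-cong λ x → cong h (≡.sym (V.assoc v (μ zero s) _)))

  -- The norm estimate removes the largest column first, so the last factor has to be moved outside;
  -- this is possible because the factors commute.
  Op-last : ∀ {q k} (μ : Fin (suc k) → Fin q → Fin M) h →
    Op μ h ≗ T (μ (fromℕ k)) (Op (μ ∘ inject₁) h)
  Op-last {k = zero}  μ h v = Op-suc μ h v
  Op-last {k = suc k} μ h v = begin
    Op μ h v                                                        ≡⟨ Op-suc μ h v ⟩
    T (μ zero) (Op (μ ∘ suc) h) v                                   ≡⟨ T-cong {μ = μ zero} (λ _ → refl) (Op-last (μ ∘ suc) h) v ⟩
    T (μ zero) (T μ-last (Op (μ ∘ suc ∘ inject₁) h)) v              ≡⟨ T-swap (μ zero) μ-last (Op (μ ∘ suc ∘ inject₁) h) v ⟩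
    T μ-last (T (μ zero) (Op (μ ∘ suc ∘ inject₁) h)) v              ≡⟨ T-cong {μ = μ-last} (λ _ → refl) (Op-suc (μ ∘ inject₁) h) v ⟨
    T μ-last (Op (μ ∘ inject₁) h) v                                 ∎
    where
    open ≡.≡-Reasoning
    μ-last = μ (fromℕ (suc k))

  h₀ : Fin M → ℤ
  h₀ v = + M ℤ.* indicator (𝟎 Fin.≟ v) ℤ.- 1ℤ

  ∑-h₀ : ∑ h₀ ≡ 0ℤ
  ∑-h₀ = begin
    ∑ h₀
      ≡⟨ ∑-+ (λ v → + M ℤ.* indicator (𝟎 Fin.≟ v)) (λ _ → ℤ.- 1ℤ) ⟩
    ∑ (λ v → + M ℤ.* indicator (𝟎 Fin.≟ v)) ℤ.+ ∑ {M} (λ _ → ℤ.- 1ℤ)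
      ≡⟨ cong₂ ℤ._+_ (≡.trans (∑-cong (λ v → ℤ.*-comm (+ M) _)) (∑-indicator 𝟎 (λ _ → + M))) (∑-const M (ℤ.- 1ℤ)) ⟩
    + M ℤ.+ + M ℤ.* ℤ.- 1ℤ  ≡⟨ cancel (+ M) ⟩
    0ℤ ∎
    where
    open ≡.≡-Reasoning
    cancel : ∀ x → x ℤ.+ x ℤ.* ℤ.- 1ℤ ≡ 0ℤ
    cancel = solve-∀

  -- The point mass in the first factor picks out `h₀ w`, while its constant part multiplies a
  -- translate of `∑ h₀`, which is zero.
  autocorrelation-h₀ : ∀ w → autocorrelation h₀ w ≡ + M ℤ.* h₀ w
  autocorrelation-h₀ w = begin
    ∑ (λ v → (+ M ℤ.* indicator (𝟎 Fin.≟ v) ℤ.- 1ℤ) ℤ.* h₀ (v ⊕ w))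
      ≡⟨ ∑-cong (λ v → expand (+ M) (indicator (𝟎 Fin.≟ v)) (h₀ (v ⊕ w))) ⟩
    ∑ (λ v → + M ℤ.* (indicator (𝟎 Fin.≟ v) ℤ.* h₀ (v ⊕ w)) ℤ.+ ℤ.- 1ℤ ℤ.* h₀ (v ⊕ w))
      ≡⟨ ∑-+ (λ v → + M ℤ.* (indicator (𝟎 Fin.≟ v) ℤ.* h₀ (v ⊕ w))) _ ⟩
    ∑ (λ v → + M ℤ.* (indicator (𝟎 Fin.≟ v) ℤ.* h₀ (v ⊕ w))) ℤ.+ ∑ (λ v → ℤ.- 1ℤ ℤ.* h₀ (v ⊕ w))
      ≡⟨ cong₂ ℤ._+_ (*-∑ (+ M) (λ v → indicator (𝟎 Fin.≟ v) ℤ.* h₀ (v ⊕ w))) (*-∑ (ℤ.- 1ℤ) (λ v → h₀ (v ⊕ w))) ⟨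
    + M ℤ.* ∑ (λ v → indicator (𝟎 Fin.≟ v) ℤ.* h₀ (v ⊕ w)) ℤ.+ ℤ.- 1ℤ ℤ.* ∑ (λ v → h₀ (v ⊕ w))
      ≡⟨ cong₂ (λ x y → + M ℤ.* x ℤ.+ ℤ.- 1ℤ ℤ.* y)
           (≡.trans (∑-indicator 𝟎 (λ v → h₀ (v ⊕ w))) (cong h₀ (V.identityˡ w)))
           (≡.trans (∑-translate h₀ w) ∑-h₀) ⟩
    + M ℤ.* h₀ w ℤ.+ 0ℤ  ≡⟨ ℤ.+-identityʳ _ ⟩
    + M ℤ.* h₀ w ∎
    where
    open ≡.≡-Reasoning
    expand : ∀ m x y → (m ℤ.* x ℤ.- 1ℤ) ℤ.* y ≡ m ℤ.* (x ℤ.* y) ℤ.+ ℤ.- 1ℤ ℤ.* y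
    expand = solve-∀

  -- By injectivity `μ y ⊖ μ x` is `𝟎` only for `y = x`, so each of the `K` rows contains the point
  -- mass exactly once. The value is zero when `K = M`, which is what makes full averages useful.
  ‖T-h₀‖² : ∀ {K} {μ : Fin K → Fin M} → Injective _≡_ _≡_ μ →
    ‖ T μ h₀ ‖² ≡ + K ℤ.* (+ M ℤ.* (+ M ℤ.- + K))
  ‖T-h₀‖² {K} {μ} μ-inj = begin
    ‖ T μ h₀ ‖²                                               ≡⟨ ‖T‖² μ h₀ ⟩
    ∑ (λ x → ∑ (λ y → autocorrelation h₀ (μ y ⊖ μ x)))        ≡⟨ ∑-cong row ⟩
    ∑ {K} (λ x → + M ℤ.* (+ M ℤ.- + K))                       ≡⟨ ∑-const K _ ⟩
    + K ℤ.* (+ M ℤ.* (+ M ℤ.- + K))                           ∎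
    where
    open ≡.≡-Reasoning
    expand : ∀ m x → m ℤ.* (m ℤ.* x ℤ.- 1ℤ) ≡ x ℤ.* (m ℤ.* m) ℤ.+ ℤ.- m
    expand = solve-∀
    collect : ∀ m k → m ℤ.* m ℤ.+ k ℤ.* ℤ.- m ≡ m ℤ.* (m ℤ.- k)
    collect = solve-∀
    row : ∀ x → ∑ (λ y → autocorrelation h₀ (μ y ⊖ μ x)) ≡ + M ℤ.* (+ M ℤ.- + K)
    row x = begin
      ∑ (λ y → autocorrelation h₀ (μ y ⊖ μ x))
        ≡⟨ ∑-cong (λ y → ≡.trans (autocorrelation-h₀ _) (≡.trans (expand (+ M) _)
             (cong (λ z → z ℤ.* (+ M ℤ.* + M) ℤ.+ ℤ.- (+ M)) (indicator-⇔ (𝟎 Fin.≟ (μ y ⊖ μ x)) (x Fin.≟ y)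
               (λ eq → μ-inj (≡.trans (≡.sym (V.identityˡ (μ x))) (≡.trans (cong (_⊕ μ x) eq) (cancel-⊖ (μ x) (μ y)))))
               (λ { refl → ≡.sym (V.inverseʳ (μ x)) }))))) ⟩
      ∑ (λ y → indicator (x Fin.≟ y) ℤ.* (+ M ℤ.* + M) ℤ.+ ℤ.- (+ M))
        ≡⟨ ∑-+ (λ y → indicator (x Fin.≟ y) ℤ.* (+ M ℤ.* + M)) (λ _ → ℤ.- (+ M)) ⟩
      ∑ (λ y → indicator (x Fin.≟ y) ℤ.* (+ M ℤ.* + M)) ℤ.+ ∑ {K} (λ y → ℤ.- (+ M))
        ≡⟨ cong₂ ℤ._+_ (∑-indicator x (λ _ → + M ℤ.* + M)) (∑-const K (ℤ.- (+ M))) ⟩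
      + M ℤ.* + M ℤ.+ + K ℤ.* ℤ.- (+ M)
        ≡⟨ collect (+ M) (+ K) ⟩
      + M ℤ.* (+ M ℤ.- + K) ∎

  ‖‖²≡0⇒≗0 : ∀ {h} → ‖ h ‖² ≡ 0ℤ → ∀ v → h v ≡ 0ℤ
  ‖‖²≡0⇒≗0 {h} eq v = square-zero (ℤ.≤-antisym (ℤ.≤-trans single (ℤ.≤-reflexive eq)) (sq-nonneg (h v)))
    where
    open ℤ.≤-Reasoning
    square-zero : ∀ {x} → x ℤ.* x ≡ 0ℤ → x ≡ 0ℤ
    square-zero {x} xx≡0 with ℤ.i*j≡0⇒i≡0∨j≡0 x xx≡0
    ... | inj₁ x≡0 = x≡0
    ... | inj₂ x≡0 = x≡0
    pick : ∀ w → indicator (v Fin.≟ w) ℤ.* (h w ℤ.* h w) ℤ.≤ h w ℤ.* h w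
    pick w with v Fin.≟ w
    ... | yes _ = ℤ.≤-reflexive (ℤ.*-identityˡ _)
    ... | no  _ = ≡.subst (ℤ._≤ h w ℤ.* h w) (≡.sym (ℤ.*-zeroˡ (h w ℤ.* h w))) (sq-nonneg (h w))
    single : h v ℤ.* h v ℤ.≤ ‖ h ‖²
    single = begin
      h v ℤ.* h v                                              ≡⟨ ∑-indicator v (λ w → h w ℤ.* h w) ⟨
      ∑ (λ w → indicator (v Fin.≟ w) ℤ.* (h w ℤ.* h w))        ≤⟨ ∑-mono pick ⟩
      ‖ h ‖²                                                   ∎

-- Linear algebra over the finite field

module VectorSpace {a ℓ} (F : FiniteField a ℓ) (n : ℕ) where
  open FiniteField F hiding (refl; zero)
  open FieldSums F
  private
    module Σ = Algebra.Properties.CommutativeMonoid.Sum +-commutativeMonoid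

  -- Vectors are represented by their indices: the group laws then hold up to propositional
  -- equality, and sums over the space are sums over a `Fin`.
  V : Set
  V = Fin (q ℕ.^ n)

  vector : V → Vector Carrier n
  vector = fromIndex

  index : Vector Carrier n → V
  index f = funToFin (to ∘ f)

  vector-index : ∀ f j → vector (index f) j ≈ f j
  vector-index f j = trans (reflexive (cong from (Fin.finToFun-funToFin (to ∘ f) j))) (from-to (f j))

  index-cong : ∀ {f g} → (∀ j → f j ≈ g j) → index f ≡ index g
  index-cong f≈g = funToFin-cong (λ j → to-cong (f≈g j))

  index-vector : ∀ v → index (vector v) ≡ v
  index-vector v = ≡.trans
    (funToFin-cong {g = finToFun {q} {n} v} (λ j → to-from (finToFun v j))) (Fin.funToFin-finToFin {n} {q} v)

  _⊕_ : V → V → V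
  v ⊕ w = index (λ j → vector v j + vector w j)

  𝟎 : V
  𝟎 = index (λ _ → 0#)

  ⊖_ : V → V
  ⊖ v = index (λ j → - vector v j)

  isAbelianGroup : IsAbelianGroup _≡_ _⊕_ 𝟎 ⊖_
  isAbelianGroup = record
    { isGroup = record
      { isMonoid = record
        { isSemigroup = record
          { isMagma = record { isEquivalence = ≡.isEquivalence ; ∙-cong = cong₂ _⊕_ }
          ; assoc = λ u v w → index-cong λ j → trans (+-congʳ (vector-index _ j))
              (trans (+-assoc _ _ _) (+-congˡ (sym (vector-index _ j))))
          }
        ; identity = (λ v → ≡.trans (index-cong λ j → trans (+-congʳ (vector-index _ j)) (+-identityˡ _)) (index-vector v))
                   , (λ v → ≡.trans (index-cong λ j → trans (+-congˡ (vector-index _ j)) (+-identityʳ _)) (index-vector v))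
        }
      ; inverse = (λ v → index-cong λ j → trans (+-congʳ (vector-index _ j)) (-‿inverseˡ _))
                , (λ v → index-cong λ j → trans (+-congˡ (vector-index _ j)) (-‿inverseʳ _))
      ; ⁻¹-cong = cong ⊖_
      }
    ; comm = λ v w → index-cong λ j → +-comm _ _
    }

  open Translations _⊕_ 𝟎 ⊖_ isAbelianGroup public
  open IteratedTranslations _⊕_ 𝟎 ⊖_ isAbelianGroup public

  vector-total : ∀ {k} (w : Vector V k) j → vector (total w) j ≈ sum (λ i → vector (w i) j)
  vector-total {zero}  w j = vector-index _ j
  vector-total {suc k} w j = trans (vector-index _ j) (+-congˡ (vector-total (w ∘ suc) j))

  line : Vector Carrier n → Carrier → V
  line a s = index (λ j → s * a j)

  line-cong : ∀ a {x y} → x ≈ y → line a x ≡ line a y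
  line-cong a x≈y = index-cong (λ j → *-congʳ x≈y)

  line-+ : ∀ a x y → line a (x + y) ≡ line a x ⊕ line a y
  line-+ a x y = index-cong λ j → trans (distribʳ (a j) x y) (+-cong (sym (vector-index _ j)) (sym (vector-index _ j)))

  vector-total-line : ∀ {k} (s : Vector Carrier k) (a : Fin k → Vector Carrier n) j →
    vector (total (λ i → line (a i) (s i))) j ≈ sum (λ i → s i * a i j)
  vector-total-line {k} s a j = trans
    (vector-total (λ i → line (a i) (s i)) j) (Σ.sum-cong-≋ {k} (λ i → vector-index (λ j → s i * a i j) j))

module Independence {a ℓ} (F : FiniteField a ℓ) where
  open FiniteField F hiding (refl; zero)
  open FieldSums F
  open import Algebra.Properties.Ring ring using (-‿distribˡ-*)
  open import Algebra.Properties.Semiring.Sum semiring using (*-distribˡ-sum; *-distribʳ-sum)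
  private
    module Σ = Algebra.Properties.CommutativeMonoid.Sum +-commutativeMonoid
  import Relation.Binary.Reasoning.Setoid setoid as ≈-Reasoning

  independent⇒cancel : ∀ {m k} (M : Matrix m k) → ColumnsIndependent M → ∀ (x y : Vector Carrier k) →
    (∀ j → sum (λ i → x i * M j i) ≈ sum (λ i → y i * M j i)) → ∀ i → x i ≈ y i
  independent⇒cancel {m} {k} M indep x y eq i = x∙y⁻¹≈ε⇒x≈y _ _ (indep (λ i → x i - y i) vanish i)
    where
    -sum : ∀ {k} (t : Vector Carrier k) → sum t + sum (λ i → - t i) ≈ 0#
    -sum {k} t = trans (sym (Σ.∑-distrib-+ t (λ i → - t i))) (sum-zero +-commutativeMonoid {k} _ (λ i → -‿inverseʳ (t i)))
    open ≈-Reasoning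
    vanish : ∀ j → sum (λ i → (x i - y i) * M j i) ≈ 0#
    vanish j = begin
      sum (λ i → (x i - y i) * M j i)
        ≈⟨ Σ.sum-cong-≋ {k} (λ i → trans (distribʳ (M j i) (x i) (- y i)) (+-congˡ (sym (-‿distribˡ-* (y i) (M j i))))) ⟩
      sum (λ i → x i * M j i + - (y i * M j i))
        ≈⟨ Σ.∑-distrib-+ {k} (λ i → x i * M j i) _ ⟩
      sum (λ i → x i * M j i) + sum (λ i → - (y i * M j i))
        ≈⟨ +-congʳ (eq j) ⟩
      sum (λ i → y i * M j i) + sum (λ i → - (y i * M j i))
        ≈⟨ -sum (λ i → y i * M j i) ⟩
      0# ∎

  -- If a column were selected twice, two different unit coefficient vectors would give the same
  -- combination.
  selection-injective : ∀ {m n k} (M : Matrix m n) (σ : Fin k → Fin n) →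
    ColumnsIndependent (selectColumns σ M) → Injective _≡_ _≡_ σ
  selection-injective M σ indep {i} {j} σi≡σj with i Fin.≟ j
  ... | yes i≡j = i≡j
  ... | no  i≢j = contradiction
    (trans (sym (δ-≢ i≢j)) (trans (independent⇒cancel (selectColumns σ M) indep (δ j) (δ i)
      (λ r → trans (sum-δ j (M r ∘ σ)) (trans (reflexive (cong (M r) (≡.sym σi≡σj))) (sym (sum-δ i (M r ∘ σ))))) i) (δ-≡ i))) 0≉1

  -- A choice of `n` independent columns among `n` is injective, hence a permutation, and
  -- independence does not depend on the order.
  fullRank⇒independent : ∀ {n} (M : Matrix n n) → HasRank M n → ColumnsIndependent M
  fullRank⇒independent {n} M ((σ , indep) , _) x eq i =
    let (i′ , σi′≡i) = surj i in
    trans (reflexive (cong x (≡.sym σi′≡i))) (indep (x ∘ σ)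
      (λ j → trans (sym (Σ.sum-permute (λ i → x i * M j i) π)) (eq j)) i′)
    where
    σ-inj = selection-injective M σ indep
    surj = injective⇒surjective σ-inj
    π : Permutation n n
    π = permutation σ (proj₁ ∘ surj) (proj₂ ∘ surj) (λ i → σ-inj (proj₂ (surj (σ i))))

  tail-independent : ∀ {m k} (M : Matrix m (suc k)) →
    ColumnsIndependent M → ColumnsIndependent (selectColumns suc M)
  tail-independent M indep x eq i = indep (0# Vector.∷ x)
    (λ j → trans (+-congʳ (zeroˡ (M j zero))) (trans (+-identityˡ _) (eq j))) (suc i)

  module _ {n t : ℕ} (n≤t : n ≤ t) (A : Matrix n t) (H : HypothesisH A) where

    -- An increasing family of columns avoiding the first r indices extends
    -- downwards by r further columns.
    increasing⇒independent : ∀ r {k} → r ℕ.+ k ≡ n → (S : Fin k → Fin t) → StrictlyIncreasing S →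
      (∀ i → r ≤ toℕ (S i)) → ColumnsIndependent (selectColumns S A)
    increasing⇒independent zero    refl S inc _ = fullRank⇒independent _ (H S inc)
    increasing⇒independent (suc r) {k} eq S inc r<S =
      tail-independent (selectColumns S′ A) (increasing⇒independent r (≡.trans (ℕ.+-suc r k) eq) S′ inc′ r≤S′)
      where
      r<t : r < t
      r<t = ℕ.≤-trans (ℕ.m≤m+n (suc r) k) (≡.subst (_≤ t) (≡.sym eq) n≤t)
      S′ : Fin (suc k) → Fin t
      S′ zero    = Fin.fromℕ< r<t
      S′ (suc i) = S i
      inc′ : StrictlyIncreasing S′
      inc′ {zero}  {suc j} _           = ≡.subst (_< toℕ (S j)) (≡.sym (Fin.toℕ-fromℕ< r<t)) (r<S j)
      inc′ {suc i} {suc j} (ℕ.s<s i<j) = inc i<j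
      r≤S′ : ∀ i → r ≤ toℕ (S′ i)
      r≤S′ zero    = ℕ.≤-reflexive (≡.sym (Fin.toℕ-fromℕ< r<t))
      r≤S′ (suc i) = ℕ.<⇒≤ (r<S i)

  module _ {n k} (A : Matrix n k) (indep : ColumnsIndependent A) where
    open VectorSpace F n

    combination : Fin (q ℕ.^ k) → V
    combination x = total (λ i → line (λ j → A j i) (from (finToFun x i)))

    vector-combination : ∀ x j → vector (combination x) j ≈ sum (λ i → from (finToFun x i) * A j i)
    vector-combination x = vector-total-line (from ∘ finToFun x) (λ i j → A j i)

    combination-injective : Injective _≡_ _≡_ combination
    combination-injective {x} {y} eq = finToFun-injective λ i → from-injective
      (independent⇒cancel A indep (from ∘ finToFun x) (from ∘ finToFun y) (λ j → trans (sym (vector-combination x j))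
        (trans (reflexive (cong (λ v → vector v j) eq)) (vector-combination y j))) i)

  -- On a finite space the injective map given by `A` is surjective. Preimages of the unit vectors
  -- form `R` with `A R = 1`, and cancelling `A` in `A (R (A x)) = A x` gives `R A = 1`.
  leftInverse : ∀ {n} (A : Matrix n n) → ColumnsIndependent A →
    Σ[ R ∈ Matrix n n ] (∀ (x : Vector Carrier n) i → x i ≈ sum (λ j → R i j * sum (λ l → x l * A j l)))
  leftInverse {n} A indep = R , λ x i → sym (independent⇒cancel A indep (λ i → sum (λ j → R i j * w x j)) x (λ j′ → begin
      sum (λ i → sum (λ j → R i j * w x j) * A j′ i)
        ≈⟨ Σ.sum-cong-≋ {n} (λ i → trans (*-distribʳ-sum (A j′ i) (λ j → R i j * w x j)) (Σ.sum-cong-≋ {n} (λ j →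
             trans (*-assoc _ _ _) (trans (*-congˡ (*-comm _ _)) (trans (sym (*-assoc _ _ _)) (*-comm _ _)))))) ⟩
      sum (λ i → sum (λ j → w x j * (R i j * A j′ i)))
        ≈⟨ Σ.∑-comm {n} {n} (λ i j → w x j * (R i j * A j′ i)) ⟩
      sum (λ j → sum (λ i → w x j * (R i j * A j′ i)))
        ≈⟨ Σ.sum-cong-≋ {n} (λ j → trans (sym (*-distribˡ-sum (w x j) (λ i → R i j * A j′ i)))
             (trans (*-congˡ (AR j j′)) (*-comm _ _))) ⟩
      sum (λ j → δ j j′ * w x j)
        ≈⟨ Σ.sum-cong-≋ {n} (λ j → *-congʳ (δ-sym j j′)) ⟩
      sum (λ j → δ j′ j * w x j)
        ≈⟨ sum-δ j′ (w x) ⟩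
      w x j′ ∎) i)
    where
    open VectorSpace F n
    open ≈-Reasoning
    w : Vector Carrier n → Vector Carrier n
    w x j = sum (λ l → x l * A j l)
    column : ∀ j → ∃[ x ] combination A indep x ≡ index (δ j)
    column j = injective⇒surjective (combination-injective A indep) (index (δ j))
    R : Matrix n n
    R i j = fromIndex (proj₁ (column j)) i
    AR : ∀ j j′ → sum (λ i → R i j * A j′ i) ≈ δ j j′
    AR j j′ = trans (sym (vector-combination A indep _ j′))
      (trans (reflexive (cong (λ v → vector v j′) (proj₂ (column j)))) (vector-index (δ j) j′))
    δ-sym : ∀ (j j′ : Fin n) → δ j j′ ≈ δ j′ j
    δ-sym j j′ with j Fin.≟ j′
    ... | yes refl = δ-≡ j
    ... | no  j≢j′ = δ-≢ (j≢j′ ∘ ≡.sym)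

-- The two moment estimates

module VarianceBound {a ℓ} (F : FiniteField a ℓ) {n t : ℕ} (n≤t : n ≤ t)
  (A : FiniteField.Matrix F n t) (H : FiniteField.HypothesisH F A)
  (d : Vector ℕ t) (E : ℕ) (0<d : ∀ i → 0 < d i) (d≤E : ∀ i → d i ≤ E)
  where
  open FiniteField F hiding (refl; zero)
  open FieldSums F
  open VectorSpace F n
  open Independence F
  open Bezout F using (#roots-≤)

  M : ℕ
  M = q ℕ.^ n

  column : Fin t → Carrier → V
  column i = line (λ j → A j i)

  powerLine fullLine : Fin t → Fin q → V
  powerLine i k = column i (from k ^ d i)
  fullLine  i k = column i (from k)

  -- The one-column inequality with its exponent replaced by the common bound `E` and its norms by
  -- natural numbers, as the induction needs it.
  ‖powerLine‖²-≤ : ∀ i h {u v} → ‖ h ‖² ℤ.≤ + u → ‖ T (fullLine i) h ‖² ℤ.≤ + v →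
    ‖ T (powerLine i) h ‖² ℤ.≤ + (2 ℕ.* (E ℕ.* (E ℕ.* (q ℕ.* u) ℕ.+ v)))
  ‖powerLine‖²-≤ i h {u} {v} h≤u Th≤v = begin
    ‖ T (powerLine i) h ‖²
      ≤⟨ Line.‖T-power‖² _⊕_ 𝟎 ⊖_ isAbelianGroup (column i) (line-cong _) (line-+ _) (d i) (#roots-≤ (0<d i)) h ⟩
    + 2 ℤ.* (+ d i ℤ.* (+ d i ℤ.* (+ q ℤ.* ‖ h ‖²) ℤ.+ ‖ T (fullLine i) h ‖²))
      ≤⟨ ℤ.*-monoˡ-≤-nonNeg (+ 2) (ℤ.*-monoˡ-≤-nonNeg (+ d i)
           (ℤ.+-mono-≤ (ℤ.*-monoˡ-≤-nonNeg (+ d i) (ℤ.*-monoˡ-≤-nonNeg (+ q) h≤u)) Th≤v)) ⟩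
    + 2 ℤ.* (+ d i ℤ.* (+ d i ℤ.* (+ q ℤ.* + u) ℤ.+ + v))
      ≡⟨ cong (λ z → + 2 ℤ.* (+ d i ℤ.* (z ℤ.+ + v)))
           (≡.trans (cong (λ z → + d i ℤ.* z) (≡.sym (ℤ.pos-* q u))) (≡.sym (ℤ.pos-* (d i) _))) ⟩
    + 2 ℤ.* (+ d i ℤ.* + (d i ℕ.* (q ℕ.* u) ℕ.+ v))
      ≡⟨ ≡.trans (cong (λ z → + 2 ℤ.* z) (≡.sym (ℤ.pos-* (d i) _))) (≡.sym (ℤ.pos-* 2 (d i ℕ.* (d i ℕ.* (q ℕ.* u) ℕ.+ v)))) ⟩
    + (2 ℕ.* (d i ℕ.* (d i ℕ.* (q ℕ.* u) ℕ.+ v)))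
      ≤⟨ ℤ.+≤+ (ℕ.*-monoʳ-≤ 2 (ℕ.*-mono-≤ (d≤E i) (ℕ.+-monoˡ-≤ v (ℕ.*-monoˡ-≤ (q ℕ.* u) (d≤E i))))) ⟩
    + (2 ℕ.* (E ℕ.* (E ℕ.* (q ℕ.* u) ℕ.+ v))) ∎
    where open ℤ.≤-Reasoning

  -- For independent columns this is `M` times the indicator of their span, minus the constant
  -- `q ^ k`.
  deviation : ∀ {k} → (Fin k → Fin t) → V → ℤ
  deviation S = Op (λ i → fullLine (S i)) h₀

  ‖deviation‖² : ∀ {k} (S : Fin k → Fin t) → ColumnsIndependent (selectColumns S A) →
    ‖ deviation S ‖² ≡ + (q ℕ.^ k) ℤ.* (+ M ℤ.* (+ M ℤ.- + (q ℕ.^ k)))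
  ‖deviation‖² S indep = ‖T-h₀‖² (combination-injective (selectColumns S A) indep)

  ‖deviation‖²-≤ : ∀ {k} (S : Fin k → Fin t) → ColumnsIndependent (selectColumns S A) →
    ‖ deviation S ‖² ℤ.≤ + (q ℕ.^ k ℕ.* (M ℕ.* M))
  ‖deviation‖²-≤ {k} S indep = begin
    ‖ deviation S ‖²                                          ≡⟨ ‖deviation‖² S indep ⟩
    + (q ℕ.^ k) ℤ.* (+ M ℤ.* (+ M ℤ.- + (q ℕ.^ k)))
      ≤⟨ ℤ.*-monoˡ-≤-nonNeg (+ (q ℕ.^ k)) (ℤ.*-monoˡ-≤-nonNeg (+ M) (ℤ.i-j≤i (+ M) (+ (q ℕ.^ k)))) ⟩
    + (q ℕ.^ k) ℤ.* (+ M ℤ.* + M)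
      ≡⟨ ≡.trans (cong (λ z → + (q ℕ.^ k) ℤ.* z) (≡.sym (ℤ.pos-* M M))) (≡.sym (ℤ.pos-* (q ℕ.^ k) _)) ⟩
    + (q ℕ.^ k ℕ.* (M ℕ.* M)) ∎
    where open ℤ.≤-Reasoning

  -- For `k = n` the factor `M - q ^ k` in the norm formula vanishes: the columns span the whole
  -- space.
  deviation-full : (S : Fin n → Fin t) → ColumnsIndependent (selectColumns S A) → ∀ v → deviation S v ≡ 0ℤ
  deviation-full S indep = ‖‖²≡0⇒≗0 {h = deviation S} (≡.trans (‖deviation‖² S indep) (vanish (+ M)))
    where
    vanish : ∀ x → x ℤ.* (x ℤ.* (x ℤ.- x)) ≡ 0ℤ
    vanish = solve-∀

  deviation-∷ : ∀ {k} i (S : Fin k → Fin t) → deviation (i Vector.∷ S) ≗ T (fullLine i) (deviation S)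
  deviation-∷ i S = Op-suc (λ j → fullLine ((i Vector.∷ S) j)) h₀

  growth : ℕ
  growth = 4 ℕ.* (E ℕ.* E)

  bound : ℕ → ℕ → ℕ
  bound m k = growth ℕ.^ m ℕ.* (q ℕ.^ m ℕ.* (q ℕ.^ k ℕ.* (M ℕ.* M)))

  -- S collects the columns over which a full average has been taken; once there
  -- are n of them the deviation from uniformity is gone.
  ‖Op-power‖²-≤ : ∀ m {k} → k ≤ n → (col : Fin m → Fin t) → StrictlyIncreasing col → (S : Fin k → Fin t) →
    StrictlyIncreasing S → (∀ i → n ≤ toℕ (col i)) → (∀ j → n ≤ toℕ (S j)) → (∀ i j → col i Fin.< S j) →
    ‖ Op (powerLine ∘ col) (deviation S) ‖² ℤ.≤ + bound m k
  ‖Op-power‖²-≤ m {k} k≤n col col-inc S S-inc n≤col n≤S col<S = go m col col-inc n≤col col<S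
    where
    indep : ColumnsIndependent (selectColumns S A)
    indep = increasing⇒independent n≤t A H (n ∸ k) (ℕ.m∸n+n≡m k≤n) S S-inc (λ i → ℕ.≤-trans (ℕ.m∸n≤m n k) (n≤S i))
    go : ∀ m (col : Fin m → Fin t) → StrictlyIncreasing col → (∀ i → n ≤ toℕ (col i)) → (∀ i j → col i Fin.< S j) →
      ‖ Op (powerLine ∘ col) (deviation S) ‖² ℤ.≤ + bound m k
    go zero col _ _ _ = ≡.subst₂ ℤ._≤_ (≡.sym (‖‖²-cong (Op-zero (powerLine ∘ col) (deviation S))))
      (cong +_ (≡.sym (≡.trans (ℕ.*-identityˡ _) (ℕ.*-identityˡ _)))) (‖deviation‖²-≤ S indep)
    go (suc m) col col-inc n≤col col<S with ℕ.m≤n⇒m<n∨m≡n k≤n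
    ... | inj₂ refl = ℤ.≤-trans (ℤ.≤-reflexive (∑-zero (λ v → cong₂ ℤ._*_ (zero-everywhere v) (zero-everywhere v)))) (ℤ.+≤+ ℕ.z≤n)
      where
      zero-everywhere : ∀ v → Op (powerLine ∘ col) (deviation S) v ≡ 0ℤ
      zero-everywhere v = ∑-zero (λ x → deviation-full S indep _)
    -- The largest power column `c` is compared with its full average. The first recursive call
    -- drops `c`; the second puts it in front of `S`, where it keeps the columns increasing, and the
    -- full average is commuted past the remaining power averages.
    ... | inj₁ k<n = begin
      ‖ Op (powerLine ∘ col) (deviation S) ‖²   ≡⟨ ‖‖²-cong (Op-last (powerLine ∘ col) (deviation S)) ⟩
      ‖ T (powerLine c) (Op (powerLine ∘ col′) (deviation S)) ‖²
        ≤⟨ ‖powerLine‖²-≤ c (Op (powerLine ∘ col′) (deviation S))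
             (go m col′ col′-inc (n≤col ∘ inject₁) (col<S ∘ inject₁))
             (≡.subst (ℤ._≤ + bound m (suc k)) (‖‖²-cong commute)
               (‖Op-power‖²-≤ m k<n col′ col′-inc (c Vector.∷ S) cS-inc (n≤col ∘ inject₁) n≤cS col′<cS)) ⟩
      + (2 ℕ.* (E ℕ.* (E ℕ.* (q ℕ.* bound m k) ℕ.+ bound m (suc k))))
        ≤⟨ ℤ.+≤+ arithmetic ⟩
      + bound (suc m) k ∎
      where
      open ℤ.≤-Reasoning
      c = col (fromℕ m)
      col′ = col ∘ inject₁
      col′-inc : StrictlyIncreasing col′
      col′-inc {i} {j} i<j = col-inc (≡.subst₂ _<_ (≡.sym (Fin.toℕ-inject₁ i)) (≡.sym (Fin.toℕ-inject₁ j)) i<j)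
      col′<c : ∀ i → col′ i Fin.< c
      col′<c i = col-inc (≡.subst₂ _<_ (≡.sym (Fin.toℕ-inject₁ i)) (≡.sym (Fin.toℕ-fromℕ m)) (Fin.toℕ<n i))
      cS-inc : StrictlyIncreasing (c Vector.∷ S)
      cS-inc {zero}  {suc j} _           = col<S (fromℕ m) j
      cS-inc {suc i} {suc j} (ℕ.s<s i<j) = S-inc i<j
      n≤cS : ∀ j → n ≤ toℕ ((c Vector.∷ S) j)
      n≤cS zero    = n≤col (fromℕ m)
      n≤cS (suc j) = n≤S j
      col′<cS : ∀ i j → col′ i Fin.< (c Vector.∷ S) j
      col′<cS i zero    = col′<c i
      col′<cS i (suc j) = col<S (inject₁ i) j
      commute : Op (powerLine ∘ col′) (deviation (c Vector.∷ S)) ≗ T (fullLine c) (Op (powerLine ∘ col′) (deviation S))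
      commute v = ≡.trans (T-cong {g = deviation (c Vector.∷ S)} (λ _ → refl) (deviation-∷ c S) v)
        (T-swap _ (fullLine c) (deviation S) v)
      instance
        E-nonZero : ℕ.NonZero E
        E-nonZero = ℕ.>-nonZero (ℕ.<-≤-trans (0<d c) (d≤E c))
      -- Here `bound m (suc k)` is `q * bound m k`, which is at most `E` times itself. The two terms
      -- in the bracket thus become equal, and the factor per column is `4 * E * E * q`.
      arithmetic : 2 ℕ.* (E ℕ.* (E ℕ.* (q ℕ.* bound m k) ℕ.+ bound m (suc k))) ≤ bound (suc m) k
      arithmetic = ℕ.≤-trans
        (ℕ.*-monoʳ-≤ 2 (ℕ.*-monoʳ-≤ E (ℕ.+-monoʳ-≤ (E ℕ.* (q ℕ.* bound m k)) (≡.subst (_≤ E ℕ.* (q ℕ.* bound m k))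
          (swap q (growth ℕ.^ m) (q ℕ.^ m) (q ℕ.^ k) (M ℕ.* M)) (ℕ.m≤n*m (q ℕ.* bound m k) E)))))
        (ℕ.≤-reflexive (collect E q (growth ℕ.^ m) (q ℕ.^ m) (q ℕ.^ k ℕ.* (M ℕ.* M))))
        where
        swap : ∀ q x y z w → q ℕ.* (x ℕ.* (y ℕ.* (z ℕ.* w))) ≡ x ℕ.* (y ℕ.* (q ℕ.* z ℕ.* w))
        swap = ℕ-RingSolver.solve-∀
        collect : ∀ E q x y z → 2 ℕ.* (E ℕ.* (E ℕ.* (q ℕ.* (x ℕ.* (y ℕ.* z))) ℕ.+ E ℕ.* (q ℕ.* (x ℕ.* (y ℕ.* z))))) ≡
          4 ℕ.* (E ℕ.* E) ℕ.* x ℕ.* (q ℕ.* y ℕ.* z)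
        collect = ℕ-RingSolver.solve-∀

-- Counting solutions by splitting the variables

module SolutionCount {a ℓ} (F : FiniteField a ℓ) {n m : ℕ} (n≤t : n ≤ n ℕ.+ m)
  (d : Vector ℕ (n ℕ.+ m)) (E : ℕ) (0<d : ∀ i → 0 < d i) (d≤E : ∀ i → d i ≤ E)
  (c : Fin n → Vector ℕ n) (c<d : ∀ j i → sumℕ (c j) < d i)
  (A : FiniteField.Matrix F n (n ℕ.+ m)) (H : FiniteField.HypothesisH F A)
  (α b : Vector (FiniteField.Carrier F) n)
  where
  open FiniteField F hiding (refl; zero)
  open FieldSums F
  open VectorSpace F n
  open Independence F
  open Bezout F
  open VarianceBound F n≤t A H d E 0<d d≤E
  open System n≤t d c A α b
  open import Algebra.Properties.Semiring.Exp semiring using (^-congˡ)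
  private
    module Σ = Algebra.Properties.CommutativeMonoid.Sum +-commutativeMonoid
    module Π = Algebra.Properties.CommutativeMonoid.Sum *-commutativeMonoid
  import Relation.Binary.Reasoning.Setoid setoid as ≈-Reasoning

  Q : ℕ
  Q = q ℕ.^ m

  power : (Fin n → Fin q) → Vector Carrier n
  power x l = from (x l) ^ d (l ↑ˡ m)

  head-sum : (Fin n → Fin q) → Vector Carrier n
  head-sum x j = sum (λ l → power x l * A j (l ↑ˡ m))

  -- The monomials on the right of the system involve only the first `n` variables, so they belong
  -- here along with the constants; the other variables enter through `g` alone.
  f : (Fin n → Fin q) → V
  f x = index (λ j → (head-sum x j + α j) - b j * monomial (c j) (from ∘ x))

  g : (Fin m → Fin q) → V
  g y = total (λ i → powerLine (n ↑ʳ i) (y i))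

  equation : ∀ x y j → let X = from ∘ concat n x y in
    lhs X j - rhs X j ≈ vector (f x ⊕ g y) j
  equation x y j = begin
    (sum (λ i → A j i * X i ^ d i) + α j) - b j * product (λ i → X (inject≤ i n≤t) ^ c j i)
      ≈⟨ +-cong (+-congʳ (sum-++ +-commutativeMonoid n (λ i → A j i * X i ^ d i)))
           (-‿cong (*-congˡ (Π.sum-cong-≋ {n} (λ i → ^-congˡ (c j i) (reflexive (cong from (X-inject i))))))) ⟩
    ((sum (λ i → A j (i ↑ˡ m) * X (i ↑ˡ m) ^ d (i ↑ˡ m)) + sum (λ i → A j (n ↑ʳ i) * X (n ↑ʳ i) ^ d (n ↑ʳ i))) + α j) - r
      ≈⟨ +-congʳ (+-congʳ (+-cong
           (Σ.sum-cong-≋ {n} (λ i → trans (*-comm _ _)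
             (*-congʳ (^-congˡ (d (i ↑ˡ m)) (reflexive (cong from (lookup-++ˡ x y i)))))))
           (Σ.sum-cong-≋ {m} (λ i → trans (*-comm _ _)
             (*-congʳ (^-congˡ (d (n ↑ʳ i)) (reflexive (cong from (lookup-++ʳ x y i))))))))) ⟩
    ((head-sum x j + s) + α j) - r
      ≈⟨ +-congʳ (trans (+-assoc _ _ _) (trans (+-congˡ (+-comm _ _)) (sym (+-assoc _ _ _)))) ⟩
    ((head-sum x j + α j) + s) - r
      ≈⟨ trans (+-assoc _ _ _) (trans (+-congˡ (+-comm _ _)) (sym (+-assoc _ _ _))) ⟩
    ((head-sum x j + α j) - r) + s
      ≈⟨ +-cong (vector-index _ j) (vector-total-line (λ i → from (y i) ^ d (n ↑ʳ i)) (λ i j → A j (n ↑ʳ i)) j) ⟨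
    vector (f x) j + vector (g y) j
      ≈⟨ vector-index _ j ⟨
    vector (f x ⊕ g y) j ∎
    where
    open ≈-Reasoning
    X = from ∘ concat n x y
    r = b j * monomial (c j) (from ∘ x)
    s = sum (λ i → from (y i) ^ d (n ↑ʳ i) * A j (n ↑ʳ i))
    X-inject : ∀ i → concat n x y (inject≤ i n≤t) ≡ x i
    X-inject i = ≡.trans (cong (concat n x y) (Fin.toℕ-injective
      (≡.trans (Fin.toℕ-inject≤ i n≤t) (≡.sym (Fin.toℕ-↑ˡ i m))))) (lookup-++ˡ x y i)

  solution⇔ : ∀ x y → indicator (isSolution? (from ∘ concat n x y)) ≡ indicator (𝟎 Fin.≟ (f x ⊕ g y))
  solution⇔ x y = indicator-⇔ (isSolution? (from ∘ concat n x y)) (𝟎 Fin.≟ (f x ⊕ g y))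
    (λ sol → ≡.trans (index-cong (λ j → sym (trans (sym (equation x y j)) (trans (+-congʳ (sol j)) (-‿inverseʳ _)))))
      (index-vector _))
    (λ eq j → x∙y⁻¹≈ε⇒x≈y _ _ (trans (equation x y j)
      (trans (reflexive (cong (λ v → vector v j) (≡.sym eq))) (vector-index _ j))))

  solutionCount-∑ : + solutionCount ≡
    ∑ᵛ q n (λ x → ∑ᵛ q m (λ y → indicator (𝟎 Fin.≟ (f x ⊕ g y))))
  solutionCount-∑ = begin
    + solutionCount
      ≡⟨ length-filter (isSolution? ∘ fromIndex) (λ i → i) ⟩
    ∑ᵛ q (n ℕ.+ m) (λ X → indicator (isSolution? (from ∘ X)))
      ≡⟨ ∑ᵛ-++ q n m (λ X → indicator (isSolution? (from ∘ X))) (λ {X} {Y} X≗Y →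
           indicator-⇔ (isSolution? (from ∘ X)) (isSolution? (from ∘ Y)) (resp X≗Y) (resp (≡.sym ∘ X≗Y))) ⟩
    ∑ᵛ q n (λ x → ∑ᵛ q m (λ y → indicator (isSolution? (from ∘ concat n x y))))
      ≡⟨ ∑-cong (λ x → ∑-cong (λ y → solution⇔ (finToFun x) (finToFun y))) ⟩
    _ ∎
    where
    open ≡.≡-Reasoning
    resp : ∀ {X Y : Fin (n ℕ.+ m) → Fin q} → X ≗ Y → IsSolution (from ∘ X) → IsSolution (from ∘ Y)
    resp {X} {Y} X≗Y sol j = trans
      (+-congʳ (Σ.sum-cong-≋ {n ℕ.+ m} (λ i → *-congˡ (^-congˡ (d i) (reflexive (cong from (≡.sym (X≗Y i))))))))
      (trans (sol j) (*-congˡ (Π.sum-cong-≋ {n} (λ i → ^-congˡ (c j i) (reflexive (cong from (X≗Y (inject≤ i n≤t))))))))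

  Ψ : V → ℤ
  Ψ = Op (λ i → powerLine (n ↑ʳ i)) h₀

  -- `Ψ (f x)` is the sum of `h₀ (f x ⊕ g y)` over `y`. Over all `M * Q` pairs, `h₀` counts `M` for
  -- each solution and `-1` for each pair.
  ∑-Ψ : + M ℤ.* (+ solutionCount ℤ.- + Q) ≡ ∑ᵛ q n (λ x → Ψ (f x))
  ∑-Ψ = ≡.sym (begin
    ∑ᵛ q n (λ x → ∑ᵛ q m (λ y → + M ℤ.* hit x y ℤ.- 1ℤ))
      ≡⟨ ∑-cong (λ x → ≡.trans (∑-+ (λ y → + M ℤ.* hit (finToFun x) (finToFun y)) (λ _ → ℤ.- 1ℤ))
           (cong₂ ℤ._+_ (≡.sym (*-∑ (+ M) (λ y → hit (finToFun x) (finToFun y)))) (∑-const Q (ℤ.- 1ℤ)))) ⟩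
    ∑ᵛ q n (λ x → + M ℤ.* ∑ᵛ q m (hit x) ℤ.+ + Q ℤ.* ℤ.- 1ℤ)
      ≡⟨ ∑-+ (λ x → + M ℤ.* ∑ᵛ q m (hit (finToFun x))) (λ _ → + Q ℤ.* ℤ.- 1ℤ) ⟩
    ∑ᵛ q n (λ x → + M ℤ.* ∑ᵛ q m (hit x)) ℤ.+ ∑ᵛ q n (λ x → + Q ℤ.* ℤ.- 1ℤ)
      ≡⟨ cong₂ ℤ._+_ (≡.sym (*-∑ (+ M) (λ x → ∑ᵛ q m (hit (finToFun x))))) (∑-const M (+ Q ℤ.* ℤ.- 1ℤ)) ⟩
    + M ℤ.* ∑ᵛ q n (λ x → ∑ᵛ q m (hit x)) ℤ.+ + M ℤ.* (+ Q ℤ.* ℤ.- 1ℤ)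
      ≡⟨ cong (λ z → + M ℤ.* z ℤ.+ + M ℤ.* (+ Q ℤ.* ℤ.- 1ℤ)) solutionCount-∑ ⟨
    + M ℤ.* + solutionCount ℤ.+ + M ℤ.* (+ Q ℤ.* ℤ.- 1ℤ)
      ≡⟨ collect (+ M) (+ solutionCount) (+ Q) ⟩
    + M ℤ.* (+ solutionCount ℤ.- + Q) ∎)
    where
    open ≡.≡-Reasoning
    hit : (Fin n → Fin q) → (Fin m → Fin q) → ℤ
    hit x y = indicator (𝟎 Fin.≟ (f x ⊕ g y))
    collect : ∀ m n q → m ℤ.* n ℤ.+ m ℤ.* (q ℤ.* ℤ.- 1ℤ) ≡ m ℤ.* (n ℤ.- q)
    collect = solve-∀

  headColumns : Matrix n n
  headColumns = selectColumns (_↑ˡ m) A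

  headColumns-independent : ColumnsIndependent headColumns
  headColumns-independent = increasing⇒independent n≤t A H 0 refl (_↑ˡ m)
    (λ {i} {j} i<j → ≡.subst₂ _<_ (≡.sym (Fin.toℕ-↑ˡ i m)) (≡.sym (Fin.toℕ-↑ˡ j m)) i<j) (λ _ → ℕ.z≤n)

  -- Inverting the first n columns of A turns f x = v into equations expressing each
  -- xᵢ ^ dᵢ through the monomials of degree below dᵢ.
  fibre-≤ : ∀ v → ∑ᵛ q n (λ x → indicator (f x Fin.≟ v)) ℤ.≤ + (E ℕ.^ n)
  fibre-≤ v = count-≤ (λ x → f (finToFun x) Fin.≟ v) (λ z z-inj fz≡v →
    #solutions-≤ (d ∘ (_↑ˡ m)) E (d≤E ∘ (_↑ˡ m)) (0<d ∘ (_↑ˡ m)) c (λ j i → c<d j (i ↑ˡ m))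
      (λ i j → R i j * b j) β (λ k → fromIndex (z k))
      (λ {k} {l} eq → z-inj (finToFun-injective {q} {n} {z k} {z l} (λ i → from-injective (eq i))))
      (λ k i → solved (finToFun (z k)) (fz≡v k) i))
    where
    R : Matrix n n
    R = proj₁ (leftInverse headColumns headColumns-independent)
    β : Vector Carrier n
    β i = sum (λ j → R i j * (vector v j - α j))
    open ≈-Reasoning
    head : ∀ x → f x ≡ v → ∀ j → head-sum x j ≈ (vector v j - α j) + b j * monomial (c j) (from ∘ x)
    head x fx≡v j = x≈ (trans (sym (vector-index _ j)) (reflexive (cong (λ w → vector w j) fx≡v)))
      where
      x≈ : ∀ {h a r w} → (h + a) - r ≈ w → h ≈ (w - a) + r
      x≈ {h} {a} {r} {w} eq = begin
        h                              ≈⟨ +-identityʳ h ⟨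
        h + 0#                         ≈⟨ +-congˡ (-‿inverseʳ a) ⟨
        h + (a - a)                    ≈⟨ +-assoc _ _ _ ⟨
        (h + a) - a                    ≈⟨ +-congʳ (+-identityʳ _) ⟨
        ((h + a) + 0#) - a             ≈⟨ +-congʳ (+-congˡ (-‿inverseˡ r)) ⟨
        ((h + a) + (- r + r)) - a      ≈⟨ +-congʳ (+-assoc _ _ _) ⟨
        (((h + a) - r) + r) - a        ≈⟨ +-congʳ (+-congʳ eq) ⟩
        (w + r) - a                    ≈⟨ +-assoc _ _ _ ⟩
        w + (r - a)                    ≈⟨ +-congˡ (+-comm _ _) ⟩
        w + (- a + r)                  ≈⟨ +-assoc _ _ _ ⟨
        (w - a) + r                    ∎
    solved : ∀ x → f x ≡ v → ∀ i → power x i ≈ β i + sum (λ j → (R i j * b j) * monomial (c j) (from ∘ x))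
    solved x fx≡v i = begin
      power x i
        ≈⟨ proj₂ (leftInverse headColumns headColumns-independent) (power x) i ⟩
      sum (λ j → R i j * head-sum x j)
        ≈⟨ Σ.sum-cong-≋ {n} (λ j → trans (*-congˡ (head x fx≡v j)) (trans (distribˡ _ _ _) (+-congˡ (sym (*-assoc _ _ _))))) ⟩
      sum (λ j → R i j * (vector v j - α j) + (R i j * b j) * monomial (c j) (from ∘ x))
        ≈⟨ Σ.∑-distrib-+ {n} (λ j → R i j * (vector v j - α j)) _ ⟩
      β i + sum (λ j → (R i j * b j) * monomial (c j) (from ∘ x)) ∎

  -- The induction starts from the empty family of full averages, for which the deviation is `h₀`
  -- itself, and with all columns from `n` on as power columns.
  ‖Ψ‖²-≤ : ‖ Ψ ‖² ℤ.≤ + bound m 0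
  ‖Ψ‖²-≤ = ≡.subst (ℤ._≤ + bound m 0)
    (‖‖²-cong (T-cong {g = deviation none} {h = h₀} (λ _ → refl) (Op-zero (λ i → fullLine (none i)) h₀)))
    (‖Op-power‖²-≤ m ℕ.z≤n (n ↑ʳ_)
      (λ {i} {j} i<j → ≡.subst₂ _<_ (≡.sym (Fin.toℕ-↑ʳ n i)) (≡.sym (Fin.toℕ-↑ʳ n j)) (ℕ.+-monoʳ-< n i<j))
      none (λ { {()} }) (λ i → ≡.subst (n ≤_) (≡.sym (Fin.toℕ-↑ʳ n i)) (ℕ.m≤m+n n (toℕ i))) (λ ()) (λ _ ()))
    where
    none : Fin 0 → Fin (n ℕ.+ m)
    none ()

  -- Multiply the error by `M` to reach the sum of `Ψ (f x)`. Then apply Cauchy-Schwarz over the `M`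
  -- values of `x`, the fibre bound for `f`, and the bound on the norm of `Ψ`; finally cancel
  -- `M * M`.
  squaredError-≤ : (+ solutionCount ℤ.- + Q) ℤ.* (+ solutionCount ℤ.- + Q) ℤ.≤ + (M ℕ.* Q ℕ.* (E ℕ.^ n ℕ.* growth ℕ.^ m))
  squaredError-≤ = ℤ.*-cancelˡ-≤-pos _ _ (+ M ℤ.* + M) (begin
    + M ℤ.* + M ℤ.* (Δ ℤ.* Δ)
      ≡⟨ square (+ M) Δ ⟩
    (+ M ℤ.* Δ) ℤ.* (+ M ℤ.* Δ)
      ≡⟨ cong₂ ℤ._*_ ∑-Ψ ∑-Ψ ⟩
    ∑ᵛ q n (λ x → Ψ (f x)) ℤ.* ∑ᵛ q n (λ x → Ψ (f x))
      ≤⟨ cauchy-schwarz (λ x → Ψ (f (finToFun x))) ⟩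
    + M ℤ.* ∑ᵛ q n (λ x → Ψ (f x) ℤ.* Ψ (f x))
      ≤⟨ ℤ.*-monoˡ-≤-nonNeg (+ M) (∑-fibres-≤ (f ∘ finToFun) (λ v → Ψ v ℤ.* Ψ v) (λ v → sq-nonneg (Ψ v)) fibre-≤) ⟩
    + M ℤ.* (+ (E ℕ.^ n) ℤ.* ‖ Ψ ‖²)
      ≤⟨ ℤ.*-monoˡ-≤-nonNeg (+ M) (ℤ.*-monoˡ-≤-nonNeg (+ (E ℕ.^ n)) ‖Ψ‖²-≤) ⟩
    + M ℤ.* (+ (E ℕ.^ n) ℤ.* + bound m 0)
      ≡⟨ cong (λ z → + M ℤ.* z) (≡.sym (ℤ.pos-* (E ℕ.^ n) (bound m 0))) ⟩
    + M ℤ.* + (E ℕ.^ n ℕ.* bound m 0)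
      ≡⟨ ≡.sym (ℤ.pos-* M (E ℕ.^ n ℕ.* bound m 0)) ⟩
    + (M ℕ.* (E ℕ.^ n ℕ.* bound m 0))
      ≡⟨ cong +_ (collect M Q (E ℕ.^ n) (growth ℕ.^ m)) ⟩
    + (M ℕ.* M ℕ.* (M ℕ.* Q ℕ.* (E ℕ.^ n ℕ.* growth ℕ.^ m)))
      ≡⟨ ℤ.pos-* (M ℕ.* M) (M ℕ.* Q ℕ.* (E ℕ.^ n ℕ.* growth ℕ.^ m)) ⟩
    + (M ℕ.* M) ℤ.* + (M ℕ.* Q ℕ.* (E ℕ.^ n ℕ.* growth ℕ.^ m))
      ≡⟨ cong (λ z → z ℤ.* + (M ℕ.* Q ℕ.* (E ℕ.^ n ℕ.* growth ℕ.^ m))) (ℤ.pos-* M M) ⟩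
    + M ℤ.* + M ℤ.* + (M ℕ.* Q ℕ.* (E ℕ.^ n ℕ.* growth ℕ.^ m)) ∎)
    where
    open ℤ.≤-Reasoning
    Δ : ℤ
    Δ = + solutionCount ℤ.- + Q
    instance
      q-nonZero : ℕ.NonZero q
      q-nonZero = ℕ.>-nonZero (ℕ.<⇒≤ 2≤q)
      MM-positive : ℤ.Positive (+ M ℤ.* + M)
      MM-positive = ≡.subst ℤ.Positive (ℤ.pos-* M M) (ℤ.positive (ℤ.+<+ (ℕ.*-mono-≤ (ℕ.m^n>0 q n) (ℕ.m^n>0 q n))))
    square : ∀ x y → x ℤ.* x ℤ.* (y ℤ.* y) ≡ (x ℤ.* y) ℤ.* (x ℤ.* y)
    square = solve-∀
    collect : ∀ M Q E X → M ℕ.* (E ℕ.* (X ℕ.* (Q ℕ.* (1 ℕ.* (M ℕ.* M))))) ≡ M ℕ.* M ℕ.* (M ℕ.* Q ℕ.* (E ℕ.* X))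
    collect = ℕ-RingSolver.solve-∀

-- Natural-number form and the final constant

+∣-∣² : ∀ k l → + (ℕ.∣ k - l ∣ ℕ.* ℕ.∣ k - l ∣) ≡ (+ k ℤ.- + l) ℤ.* (+ k ℤ.- + l)
+∣-∣² k l with ℕ.≤-total k l
... | inj₁ k≤l rewrite ℕ.m≤n⇒∣m-n∣≡n∸m k≤l | ℤ.m-n≡m⊖n k l | ℤ.⊖-≤ k≤l =
  ≡.trans (ℤ.pos-* (l ∸ k) (l ∸ k)) (neg-square (+ (l ∸ k)))
  where
  neg-square : ∀ x → x ℤ.* x ≡ ℤ.- x ℤ.* ℤ.- x
  neg-square = solve-∀
... | inj₂ l≤k rewrite ℕ.m≤n⇒∣n-m∣≡n∸m l≤k | ℤ.m-n≡m⊖n k l | ℤ.⊖-≥ l≤k = ℤ.pos-* (k ∸ l) (k ∸ l)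

-- With `B = 6 * n * E` one has `2 * E ≤ B`, so both `E` and `4 * E * E` are at most `B ^ 2`. This
-- uses `n + m` factors `B ^ 2`; the last one is slack.
numeric-bound : ∀ n m E .{{_ : ℕ.NonZero n}} .{{_ : ℕ.NonZero E}} →
  E ℕ.^ n ℕ.* (4 ℕ.* (E ℕ.* E)) ℕ.^ m ≤ ((6 ℕ.* n ℕ.* E) ℕ.^ (n ℕ.+ m ℕ.+ 1)) ℕ.^ 2
numeric-bound n m E = begin
  E ℕ.^ n ℕ.* (4 ℕ.* (E ℕ.* E)) ℕ.^ m     ≤⟨ ℕ.*-mono-≤ (ℕ.^-monoˡ-≤ n E≤B²) (ℕ.^-monoˡ-≤ m 4E²≤B²) ⟩
  (B ℕ.^ 2) ℕ.^ n ℕ.* (B ℕ.^ 2) ℕ.^ m     ≡⟨ ℕ.^-distribˡ-+-* (B ℕ.^ 2) n m ⟨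
  (B ℕ.^ 2) ℕ.^ (n ℕ.+ m)                 ≤⟨ ℕ.^-monoʳ-≤ (B ℕ.^ 2) (ℕ.m≤m+n (n ℕ.+ m) 1) ⟩
  (B ℕ.^ 2) ℕ.^ (n ℕ.+ m ℕ.+ 1)           ≡⟨ ℕ.^-*-assoc B 2 (n ℕ.+ m ℕ.+ 1) ⟩
  B ℕ.^ (2 ℕ.* (n ℕ.+ m ℕ.+ 1))           ≡⟨ cong (B ℕ.^_) (ℕ.*-comm 2 (n ℕ.+ m ℕ.+ 1)) ⟩
  B ℕ.^ ((n ℕ.+ m ℕ.+ 1) ℕ.* 2)           ≡⟨ ℕ.^-*-assoc B (n ℕ.+ m ℕ.+ 1) 2 ⟨
  (B ℕ.^ (n ℕ.+ m ℕ.+ 1)) ℕ.^ 2           ∎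
  where
  open ℕ.≤-Reasoning
  B : ℕ
  B = 6 ℕ.* n ℕ.* E
  2E≤B : 2 ℕ.* E ≤ B
  2E≤B = ℕ.*-monoˡ-≤ E (ℕ.≤-trans (ℕ.*-monoˡ-≤ 1 (ℕ.s≤s (ℕ.s≤s (ℕ.z≤n {4})))) (ℕ.*-monoʳ-≤ 6 (ℕ.>-nonZero⁻¹ n)))
  4E²≤B² : 4 ℕ.* (E ℕ.* E) ≤ B ℕ.^ 2
  4E²≤B² = ≡.subst (_≤ B ℕ.^ 2) (square E) (ℕ.^-monoˡ-≤ 2 2E≤B)
    where
    square : ∀ E → 2 ℕ.* E ℕ.* (2 ℕ.* E ℕ.* 1) ≡ 4 ℕ.* (E ℕ.* E)
    square = ℕ-RingSolver.solve-∀
  E≤B² : E ≤ B ℕ.^ 2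
  E≤B² = ℕ.≤-trans (ℕ.m≤m*n E E) (ℕ.≤-trans (ℕ.m≤n*m (E ℕ.* E) 4) 4E²≤B²)
  instance
    B²-nonZero : ℕ.NonZero (B ℕ.^ 2)
    B²-nonZero = ℕ.>-nonZero (ℕ.<-≤-trans (ℕ.>-nonZero⁻¹ E) E≤B²)

≤-firstIndex : ∀ {t} .{{_ : ℕ.NonZero t}} (d : Vector ℕ t) → StrictlyDecreasing d → ∀ i → d i ≤ d (firstIndex t)
≤-firstIndex {suc t} d d-dec zero    = ℕ.≤-refl
≤-firstIndex {suc t} d d-dec (suc i) = ℕ.<⇒≤ (d-dec (ℕ.s≤s ℕ.z≤n))

lastIndex-≤ : ∀ {t} .{{_ : ℕ.NonZero t}} (d : Vector ℕ t) → StrictlyDecreasing d → ∀ i → d (lastIndex t) ≤ d i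
lastIndex-≤ {suc t} d d-dec i with ℕ.m≤n⇒m<n∨m≡n (Fin.≤fromℕ i)
... | inj₁ i<last = ℕ.<⇒≤ (d-dec i<last)
... | inj₂ i≡last = ℕ.≤-reflexive (cong d (Fin.toℕ-injective (≡.sym i≡last)))

-- Both sides of the estimate are squared, which removes the half-integral power of `q`.
mainTheorem13 : ∀ {c₀ ℓ₀} (F : FiniteField c₀ ℓ₀) →
    let open FiniteField F in
    (n t : ℕ) .{{_ : NonZero n}} .{{_ : NonZero t}} →
    (n<[t-1]/2 : 2 ℕ.* n < t ∸ 1) →
    (p : ℕ) → IsCharacteristic p →
    (d : Vector ℕ t) → StrictlyDecreasing d → 2 ≤ d (lastIndex t) →
    (∀ i → ¬ (p ∣ d i)) →
    (c : Fin n → Vector ℕ n) → (∀ j i → 0 < c j i) →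
    (∀ j → sumℕ (c j) < d (lastIndex t)) →
    (A : Matrix n t) → HypothesisH A →
    (a : Vector Carrier n) → (∃[ j ] ¬ (a j ≈ 0#)) →
    (b : Vector Carrier n) → (∀ j → ¬ (b j ≈ 0#)) →
    let N = System.solutionCount (2n<t-1⇒n≤t n<[t-1]/2) d c A a b in
    ∣ N - q ℕ.^ (t ∸ n) ∣ ℕ.^ 2 ≤
    q ℕ.^ t ℕ.* ((6 ℕ.* n ℕ.* d (firstIndex t)) ℕ.^ (t ℕ.+ 1)) ℕ.^ 2
mainTheorem13 F n t n<[t-1]/2 p _ d d-dec 2≤d _ c _ c<d A H a _ b _
  -- `m` is the number of variables beyond the first `n`, so that `t` becomes `n + m`.
  with m , refl ← ℕ.m≤n⇒∃[o]m+o≡n {n} {t} (2n<t-1⇒n≤t n<[t-1]/2) = begin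
    ∣ N - q ℕ.^ ((n ℕ.+ m) ∸ n) ∣ ℕ.^ 2
      ≡⟨ cong (λ k → ∣ N - q ℕ.^ k ∣ ℕ.^ 2) (ℕ.m+n∸m≡n n m) ⟩
    ∣ N - q ℕ.^ m ∣ ℕ.^ 2
      ≡⟨ cong (∣ N - q ℕ.^ m ∣ ℕ.*_) (ℕ.*-identityʳ _) ⟩
    ∣ N - q ℕ.^ m ∣ ℕ.* ∣ N - q ℕ.^ m ∣
      ≤⟨ ℤ.drop‿+≤+ (ℤ.≤-trans (ℤ.≤-reflexive (+∣-∣² N (q ℕ.^ m))) squaredError-≤) ⟩
    q ℕ.^ n ℕ.* q ℕ.^ m ℕ.* (E ℕ.^ n ℕ.* (4 ℕ.* (E ℕ.* E)) ℕ.^ m)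
      ≡⟨ cong (ℕ._* (E ℕ.^ n ℕ.* (4 ℕ.* (E ℕ.* E)) ℕ.^ m)) (ℕ.^-distribˡ-+-* q n m) ⟨
    q ℕ.^ (n ℕ.+ m) ℕ.* (E ℕ.^ n ℕ.* (4 ℕ.* (E ℕ.* E)) ℕ.^ m)
      ≤⟨ ℕ.*-monoʳ-≤ (q ℕ.^ (n ℕ.+ m)) (numeric-bound n m E) ⟩
    q ℕ.^ (n ℕ.+ m) ℕ.* ((6 ℕ.* n ℕ.* E) ℕ.^ (n ℕ.+ m ℕ.+ 1)) ℕ.^ 2 ∎
  where
  open FiniteField F using (q; module System)
  open ℕ.≤-Reasoning
  E : ℕ
  E = d (firstIndex (n ℕ.+ m))
  N : ℕ
  N = System.solutionCount (2n<t-1⇒n≤t n<[t-1]/2) d c A a b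
  0<d : ∀ i → 0 < d i
  0<d i = ℕ.≤-trans (ℕ.<⇒≤ 2≤d) (lastIndex-≤ d d-dec i)
  instance
    E-nonZero : ℕ.NonZero E
    E-nonZero = ℕ.>-nonZero (0<d (firstIndex (n ℕ.+ m)))
  -- The exponents all lie between the last and the first: the first serves as `E`, and the degree
  -- bound against the last passes to every `d i`.
  open SolutionCount F {n} {m} (2n<t-1⇒n≤t n<[t-1]/2) d E 0<d (≤-firstIndex d d-dec)
    c (λ j i → ℕ.<-≤-trans (c<d j) (lastIndex-≤ d d-dec i)) A H a b using (squaredError-≤)
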